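{- For all sufficiently large $d$ and every degree-$d$ polynomial $p_d(x)$, $$\sup_{x\in[0,\infty)}\left|e^{ -x}-\frac{1}{p_d(x)}\right|\ge 50^{ -d}.$$
   Context: Polynomials are univariate with real coefficients. "Sufficiently large" means that there is a universal $d_0$ such that the claim holds for every integer $d\ge d_0$ and every degree-$d$ polynomial. -}

module Defs where

open import Data.Nat.Base as ℕ using (ℕ; zero; suc; _!; z≤n; s≤s)
import Data.Nat.Properties as ℕ
open import Data.Integer.Base using (+_; -[1+_])
import Data.Integer.Base as ℤ
import Data.Integer.Properties as ℤ
import Data.Rational.Unnormalised.Base as ℚᵘ
import Data.Rational.Unnormalised.Properties as ℚᵘ
open import Data.Rational.Base as ℚ using (ℚ; mkℚ; 0ℚ; 1ℚ; ½; _/_)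
import Data.Rational.Properties as ℚ
open import Data.Rational.Solver using (module +-*-Solver)
open import Algebra.Definitions.RawSemiring ℚ.+-*-rawSemiring using (_^_) public
open import Data.Product.Base using (Σ; _×_; _,_; proj₁; proj₂)
open import Data.Sum.Base using (_⊎_; inj₁; inj₂; [_,_]′)
open import Data.Vec.Base using (Vec; []; _∷_; last)
open import Relation.Nullary using (¬_; yes; no; contradiction)
open import Relation.Binary.PropositionalEquality
open import Function.Base using (_∘_)

module ℚ-Lemmas where
  open import Data.Rational.Base using (_+_; _*_; _-_; -_; ∣_∣; _≤_; _<_)
  open ℚ.≤-Reasoning
  open +-*-Solver using (solve; _:+_; _:*_; _:-_; :-_; _:=_; con)

  ι : ℕ → ℚ
  ι n = + n / 1

  abstract
    0≤1 : 0ℚ ≤ 1ℚ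
    0≤1 = ℚ.*≤* (ℤ.+≤+ z≤n)

    0<1 : 0ℚ < 1ℚ
    0<1 = ℚ.*<* (ℤ.+<+ (s≤s z≤n))

    *-nonNeg : ∀ {a b} → 0ℚ ≤ a → 0ℚ ≤ b → 0ℚ ≤ a * b
    *-nonNeg {a} {b} 0≤a 0≤b = begin
      0ℚ      ≡⟨ ℚ.*-zeroˡ b ⟨
      0ℚ * b  ≤⟨ ℚ.*-monoʳ-≤-nonNeg b {{ℚ.nonNegative 0≤b}} 0≤a ⟩
      a * b   ∎

    *-pos : ∀ {a b} → 0ℚ < a → 0ℚ < b → 0ℚ < a * b
    *-pos {a} {b} 0<a 0<b =
      ℚ.positive⁻¹ (a * b) {{ℚ.pos*pos⇒pos a {{ℚ.positive 0<a}} b {{ℚ.positive 0<b}}}}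

    *-mono-≤ : ∀ {a b c d} → 0ℚ ≤ b → 0ℚ ≤ c → a ≤ b → c ≤ d → a * c ≤ b * d
    *-mono-≤ {a} {b} {c} {d} 0≤b 0≤c a≤b c≤d = begin
      a * c  ≤⟨ ℚ.*-monoʳ-≤-nonNeg c {{ℚ.nonNegative 0≤c}} a≤b ⟩
      b * c  ≤⟨ ℚ.*-monoˡ-≤-nonNeg b {{ℚ.nonNegative 0≤b}} c≤d ⟩
      b * d  ∎

    ∣*∣-mono : ∀ {a b A B} → ∣ a ∣ ≤ A → ∣ b ∣ ≤ B → ∣ a * b ∣ ≤ A * B
    ∣*∣-mono {a} {b} {A} {B} a≤ b≤ = begin
      ∣ a * b ∣      ≡⟨ ℚ.∣p*q∣≡∣p∣*∣q∣ a b ⟩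
      ∣ a ∣ * ∣ b ∣  ≤⟨ *-mono-≤ (ℚ.≤-trans (ℚ.0≤∣p∣ a) a≤) (ℚ.0≤∣p∣ b) a≤ b≤ ⟩
      A * B          ∎

    ∣+∣-mono : ∀ {a b A B} → ∣ a ∣ ≤ A → ∣ b ∣ ≤ B → ∣ a + b ∣ ≤ A + B
    ∣+∣-mono {a} {b} a≤ b≤ = ℚ.≤-trans (ℚ.∣p+q∣≤∣p∣+∣q∣ a b) (ℚ.+-mono-≤ a≤ b≤)

    ∣-∣-comm : ∀ a b → ∣ a - b ∣ ≡ ∣ b - a ∣
    ∣-∣-comm a b = trans (sym (ℚ.∣-p∣≡∣p∣ (a - b)))
      (cong ∣_∣ (solve 2 (λ a b → :- (a :- b) := b :- a) refl a b))

    triangle : ∀ a b c → ∣ a - c ∣ ≤ ∣ a - b ∣ + ∣ b - c ∣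
    triangle a b c = begin
      ∣ a - c ∣              ≡⟨ cong ∣_∣ (solve 3 (λ a b c → a :- c := (a :- b) :+ (b :- c)) refl a b c) ⟩
      ∣ (a - b) + (b - c) ∣  ≤⟨ ℚ.∣p+q∣≤∣p∣+∣q∣ (a - b) (b - c) ⟩
      ∣ a - b ∣ + ∣ b - c ∣  ∎

    -- a = b + (a - b)
    ∣∣-shift : ∀ a b → ∣ a ∣ ≤ ∣ b ∣ + ∣ a - b ∣
    ∣∣-shift a b = begin
      ∣ a ∣              ≡⟨ cong ∣_∣ (solve 2 (λ a b → a := b :+ (a :- b)) refl a b) ⟩
      ∣ b + (a - b) ∣    ≤⟨ ℚ.∣p+q∣≤∣p∣+∣q∣ b (a - b) ⟩
      ∣ b ∣ + ∣ a - b ∣  ∎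

    ∣∣-lipschitz : ∀ a b → ∣ ∣ a ∣ - ∣ b ∣ ∣ ≤ ∣ a - b ∣
    ∣∣-lipschitz a b with ℚ.∣p∣≡p∨∣p∣≡-p (∣ a ∣ - ∣ b ∣)
    ... | inj₁ eq = begin
      ∣ ∣ a ∣ - ∣ b ∣ ∣              ≡⟨ eq ⟩
      ∣ a ∣ - ∣ b ∣                  ≤⟨ ℚ.+-monoˡ-≤ (- ∣ b ∣) (∣∣-shift a b) ⟩
      (∣ b ∣ + ∣ a - b ∣) - ∣ b ∣    ≡⟨ solve 2 (λ x y → (x :+ y) :- x := y) refl ∣ b ∣ ∣ a - b ∣ ⟩
      ∣ a - b ∣                      ∎
    ... | inj₂ eq = begin
      ∣ ∣ a ∣ - ∣ b ∣ ∣              ≡⟨ eq ⟩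
      - (∣ a ∣ - ∣ b ∣)              ≡⟨ solve 2 (λ x y → :- (x :- y) := y :- x) refl ∣ a ∣ ∣ b ∣ ⟩
      ∣ b ∣ - ∣ a ∣                  ≤⟨ ℚ.+-monoˡ-≤ (- ∣ a ∣) (∣∣-shift b a) ⟩
      (∣ a ∣ + ∣ b - a ∣) - ∣ a ∣    ≡⟨ solve 2 (λ x y → (x :+ y) :- x := y) refl ∣ a ∣ ∣ b - a ∣ ⟩
      ∣ b - a ∣                      ≡⟨ ∣-∣-comm b a ⟩
      ∣ a - b ∣                      ∎

    p≤∣p∣ : ∀ p → p ≤ ∣ p ∣
    p≤∣p∣ p with ℚ.≤-total 0ℚ p
    ... | inj₁ 0≤p = ℚ.≤-reflexive (sym (ℚ.0≤p⇒∣p∣≡p 0≤p))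
    ... | inj₂ p≤0 = ℚ.≤-trans p≤0 (ℚ.0≤∣p∣ p)

    0<½ : 0ℚ < ½
    0<½ = ℚ.*<* (ℤ.+<+ (s≤s z≤n))

    0<half : ∀ {ε} → 0ℚ < ε → 0ℚ < ε * ½
    0<half 0<ε = *-pos 0<ε 0<½

    half+half : ∀ ε → ε * ½ + ε * ½ ≡ ε
    half+half ε = trans (sym (ℚ.*-distribˡ-+ ε ½ ½)) (ℚ.*-identityʳ ε)

    scale : ∀ {K ε} → 0ℚ < K → 0ℚ < ε → Σ ℚ λ δ → 0ℚ < δ × K * δ ≡ ε
    scale {K} {ε} 0<K 0<ε = ε * 1/K , *-pos 0<ε 0<1/K , (begin-equality
      K * (ε * 1/K)  ≡⟨ solve 3 (λ k e i → k :* (e :* i) := e :* (k :* i)) refl K ε 1/K ⟩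
      ε * (K * 1/K)  ≡⟨ cong (ε *_) (ℚ.*-inverseʳ K {{K≢0}}) ⟩
      ε * 1ℚ         ≡⟨ ℚ.*-identityʳ ε ⟩
      ε              ∎)
      where
      K-pos : ℚ.Positive K
      K-pos = ℚ.positive 0<K
      K≢0 : ℚ.NonZero K
      K≢0 = ℚ.pos⇒nonZero K {{K-pos}}
      1/K : ℚ
      1/K = (ℚ.1/ K) {{K≢0}}
      0<1/K : 0ℚ < 1/K
      0<1/K = ℚ.positive⁻¹ 1/K {{ℚ.1/pos⇒pos K {{K-pos}}}}

    *-cancel-≤ : ∀ {K a b} → 0ℚ < K → K * a ≤ K * b → a ≤ b
    *-cancel-≤ {K} 0<K = ℚ.*-cancelˡ-≤-pos K {{ℚ.positive 0<K}}

    /-normal : ∀ n d → ℚ.toℚᵘ (n / suc d) ℚᵘ.≃ ℚᵘ.mkℚᵘ n d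
    /-normal n d = ℚ.toℚᵘ-fromℚᵘ (ℚᵘ.mkℚᵘ n d)

    ι-mono : ∀ {m n} → m ℕ.≤ n → ι m ≤ ι n
    ι-mono {m} {n} m≤n = ℚ.toℚᵘ-cancel-≤
      (ℚᵘ.≤-respˡ-≃ (ℚᵘ.≃-sym (/-normal (+ m) 0)) (ℚᵘ.≤-respʳ-≃ (ℚᵘ.≃-sym (/-normal (+ n) 0))
        (ℚᵘ.*≤* (ℤ.*-monoʳ-≤-nonNeg (+ 1) (ℤ.+≤+ m≤n)))))

    archimedean : ∀ q → Σ ℕ λ n → q ≤ ι n
    archimedean q@(mkℚ n d _) = ℤ.∣ n ∣ , ℚ.toℚᵘ-cancel-≤
      (ℚᵘ.≤-respʳ-≃ (ℚᵘ.≃-sym (/-normal (+ ℤ.∣ n ∣) 0))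
        (ℚᵘ.*≤* (subst₂ ℤ._≤_ (sym (ℤ.*-identityʳ n)) refl (aux n))))
      where
      aux : ∀ n → n ℤ.≤ (+ ℤ.∣ n ∣) ℤ.* + suc d
      aux (+ n)    = subst (+ n ℤ.≤_) (ℤ.pos-* n (suc d)) (ℤ.+≤+ (ℕ.m≤m*n n (suc d)))
      aux -[1+ n ] = ℤ.-≤+

    1/-* : ∀ m n .{{_ : ℕ.NonZero m}} .{{_ : ℕ.NonZero n}} .{{_ : ℕ.NonZero (m ℕ.* n)}} →
           + 1 / (m ℕ.* n) ≡ (+ 1 / m) * (+ 1 / n)
    1/-* (suc m) (suc n) = ℚ.toℚᵘ-injective (ℚᵘ.≃-trans (/-normal (+ 1) (n ℕ.+ m ℕ.* suc n))
      (ℚᵘ.≃-sym (ℚᵘ.≃-trans (ℚ.toℚᵘ-homo-* (+ 1 / suc m) (+ 1 / suc n))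
        (ℚᵘ.≃-trans (ℚᵘ.*-cong (/-normal (+ 1) m) (/-normal (+ 1) n)) (ℚᵘ.*≡* refl)))))

    ι-inverse : ∀ n .{{_ : ℕ.NonZero n}} → ι n * (+ 1 / n) ≡ 1ℚ
    ι-inverse (suc n) = ℚ.toℚᵘ-injective (ℚᵘ.≃-trans (ℚ.toℚᵘ-homo-* (ι (suc n)) (+ 1 / suc n))
        (ℚᵘ.≃-trans (ℚᵘ.*-cong (/-normal (+ suc n) 0) (/-normal (+ 1) n))
          (ℚᵘ.*≡* (cong (+_ ∘ suc) (trans (trans (ℕ.*-identityʳ _) (ℕ.*-identityʳ n))
            (sym (trans (ℕ.+-identityʳ _) (ℕ.+-identityʳ n))))))))

    1/-nonNeg : ∀ n .{{_ : ℕ.NonZero n}} → 0ℚ ≤ + 1 / n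
    1/-nonNeg (suc n) = ℚ.nonNegative⁻¹ (+ 1 / suc n) {{ℚ.normalize-nonNeg 1 (suc n)}}

open ℚ-Lemmas

-- A real number is a Cauchy sequence of rationals; equality of reals is _≈_.
IsCauchy : (ℕ → ℚ) → Set
IsCauchy s = ∀ {ε} → 0ℚ ℚ.< ε →
  Σ ℕ λ N → ∀ {m n} → N ℕ.≤ m → N ℕ.≤ n → ℚ.∣ s m ℚ.- s n ∣ ℚ.≤ ε

record ℝ : Set where
  constructor mkℝ
  field
    seq    : ℕ → ℚ
    cauchy : IsCauchy seq

open ℝ public

infix 4 _≈_ _≉_ _≤_ _<_ _#_

record _≈_ (x y : ℝ) : Set where
  constructor mk≈
  field
    close : ∀ {ε} → 0ℚ ℚ.< ε →
      Σ ℕ λ N → ∀ {n} → N ℕ.≤ n → ℚ.∣ seq x n ℚ.- seq y n ∣ ℚ.≤ ε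

record _≤_ (x y : ℝ) : Set where
  constructor mk≤
  field
    below : ∀ {ε} → 0ℚ ℚ.< ε →
      Σ ℕ λ N → ∀ {n} → N ℕ.≤ n → seq x n ℚ.≤ seq y n ℚ.+ ε

record _<_ (x y : ℝ) : Set where
  constructor mk<
  field
    gap       : ℚ
    0<gap     : 0ℚ ℚ.< gap
    threshold : ℕ
    separated : ∀ {n} → threshold ℕ.≤ n → seq x n ℚ.+ gap ℚ.≤ seq y n

_≉_ _#_ : ℝ → ℝ → Set
x ≉ y = ¬ (x ≈ y)
x # y = x < y ⊎ y < x

fromℚ : ℚ → ℝ
fromℚ q = mkℝ (λ _ → q) λ 0<ε → 0 , λ _ _ →
  subst (ℚ._≤ _) (cong ℚ.∣_∣ (sym (ℚ.+-inverseʳ q))) (ℚ.<⇒≤ 0<ε)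

0ℝ 1ℝ : ℝ
0ℝ = fromℚ 0ℚ
1ℝ = fromℚ 1ℚ

private
  EventuallyBounded : (ℕ → ℚ) → Set
  EventuallyBounded s =
    Σ ℚ λ B → 0ℚ ℚ.< B × Σ ℕ λ N → ∀ {n} → N ℕ.≤ n → ℚ.∣ s n ∣ ℚ.≤ B

bounded : (x : ℝ) → EventuallyBounded (seq x)
bounded x with cauchy x 0<1
... | N , close =
  ℚ.∣ seq x N ∣ ℚ.+ 1ℚ ,
  ℚ.+-mono-≤-< (ℚ.0≤∣p∣ (seq x N)) 0<1 ,
  N , λ {n} N≤n → ℚ.≤-trans (∣∣-shift (seq x n) (seq x N))
                    (ℚ.+-monoʳ-≤ ℚ.∣ seq x N ∣ (close N≤n ℕ.≤-refl))

private
  dominated : ∀ x s {K} → 0ℚ ℚ.< K →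
    (Σ ℕ λ N → ∀ {m n} → N ℕ.≤ m → N ℕ.≤ n →
      ℚ.∣ s m ℚ.- s n ∣ ℚ.≤ K ℚ.* ℚ.∣ seq x m ℚ.- seq x n ∣) →
    IsCauchy s
  dominated x s {K} 0<K (M , dom) 0<ε with scale 0<K 0<ε
  ... | δ , 0<δ , Kδ≡ε with cauchy x 0<δ
  ... | N , close = M ℕ.⊔ N , λ {m} {n} m≥ n≥ → ℚ.≤-trans
    (dom (ℕ.m⊔n≤o⇒m≤o M N m≥) (ℕ.m⊔n≤o⇒m≤o M N n≥))
    (subst (K ℚ.* ℚ.∣ seq x m ℚ.- seq x n ∣ ℚ.≤_) Kδ≡ε
      (ℚ.*-monoˡ-≤-nonNeg K {{ℚ.nonNegative (ℚ.<⇒≤ 0<K)}}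
        (close (ℕ.m⊔n≤o⇒n≤o M N m≥) (ℕ.m⊔n≤o⇒n≤o M N n≥))))

infixl 6 _+_ _-_
infixl 7 _*_
infix  8 -_

_+_ : ℝ → ℝ → ℝ
x + y = mkℝ (λ n → seq x n ℚ.+ seq y n) +-cauchy
  where
  open +-*-Solver
  +-cauchy : IsCauchy (λ n → seq x n ℚ.+ seq y n)
  +-cauchy {ε} 0<ε with cauchy x (0<half 0<ε) | cauchy y (0<half 0<ε)
  ... | M , closeˣ | N , closeʸ = M ℕ.⊔ N , λ {m} {n} m≥ n≥ →
    subst₂ ℚ._≤_
      (cong ℚ.∣_∣ (solve 4 (λ a b c d → (a :- b) :+ (c :- d) := (a :+ c) :- (b :+ d))
        refl (seq x m) (seq x n) (seq y m) (seq y n)))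
      (half+half ε)
      (∣+∣-mono (closeˣ (ℕ.m⊔n≤o⇒m≤o M N m≥) (ℕ.m⊔n≤o⇒m≤o M N n≥))
                (closeʸ (ℕ.m⊔n≤o⇒n≤o M N m≥) (ℕ.m⊔n≤o⇒n≤o M N n≥)))

-_ : ℝ → ℝ
- x = mkℝ (λ n → ℚ.- seq x n) (dominated x (λ n → ℚ.- seq x n) 0<1 (0 , λ {m} {n} _ _ → ℚ.≤-reflexive (eq m n)))
  where
  open +-*-Solver
  eq : ∀ m n → ℚ.∣ (ℚ.- seq x m) ℚ.- (ℚ.- seq x n) ∣ ≡ 1ℚ ℚ.* ℚ.∣ seq x m ℚ.- seq x n ∣
  eq m n = trans
    (cong ℚ.∣_∣ (solve 2 (λ a b → (:- a) :- (:- b) := b :- a) refl (seq x m) (seq x n)))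
    (trans (∣-∣-comm (seq x n) (seq x m)) (sym (ℚ.*-identityˡ _)))

_-_ : ℝ → ℝ → ℝ
x - y = x + (- y)

∣_∣ : ℝ → ℝ
∣ x ∣ = mkℝ (λ n → ℚ.∣ seq x n ∣) (dominated x (λ n → ℚ.∣ seq x n ∣) 0<1 (0 , λ {m} {n} _ _ →
  subst (ℚ.∣ ℚ.∣ seq x m ∣ ℚ.- ℚ.∣ seq x n ∣ ∣ ℚ.≤_) (sym (ℚ.*-identityˡ _))
    (∣∣-lipschitz (seq x m) (seq x n))))

_*_ : ℝ → ℝ → ℝ
x * y = mkℝ (λ n → seq x n ℚ.* seq y n) *-cauchy
  where
  open +-*-Solver
  *-cauchy : IsCauchy (λ n → seq x n ℚ.* seq y n)
  *-cauchy {ε} 0<ε with bounded x | bounded y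
  ... | A , 0<A , M , x≤A | B , 0<B , N , y≤B
    with scale 0<A (0<half 0<ε) | scale 0<B (0<half 0<ε)
  ... | δ , 0<δ , Aδ≡ | η , 0<η , Bη≡ with cauchy y 0<δ | cauchy x 0<η
  ... | P , closeʸ | Q , closeˣ = (M ℕ.⊔ N) ℕ.⊔ (P ℕ.⊔ Q) , λ {m} {n} m≥ n≥ →
    let m≥₁ = ℕ.m⊔n≤o⇒m≤o (M ℕ.⊔ N) (P ℕ.⊔ Q) m≥
        m≥₂ = ℕ.m⊔n≤o⇒n≤o (M ℕ.⊔ N) (P ℕ.⊔ Q) m≥
        n≥₁ = ℕ.m⊔n≤o⇒m≤o (M ℕ.⊔ N) (P ℕ.⊔ Q) n≥
        n≥₂ = ℕ.m⊔n≤o⇒n≤o (M ℕ.⊔ N) (P ℕ.⊔ Q) n≥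
    in subst₂ ℚ._≤_
      (cong ℚ.∣_∣ (solve 4 (λ a b c d → a :* (c :- d) :+ d :* (a :- b) := a :* c :- b :* d)
        refl (seq x m) (seq x n) (seq y m) (seq y n)))
      (trans (cong₂ ℚ._+_ Aδ≡ Bη≡) (half+half ε))
      (∣+∣-mono
        (∣*∣-mono {seq x m} (x≤A (ℕ.m⊔n≤o⇒m≤o M N m≥₁))
          (closeʸ (ℕ.m⊔n≤o⇒m≤o P Q m≥₂) (ℕ.m⊔n≤o⇒m≤o P Q n≥₂)))
        (∣*∣-mono {seq y n} (y≤B (ℕ.m⊔n≤o⇒n≤o M N n≥₁))
          (closeˣ (ℕ.m⊔n≤o⇒n≤o P Q m≥₂) (ℕ.m⊔n≤o⇒n≤o P Q n≥₂))))

-- The value at 0 is never used in the limit: if x # 0ℝ, then only finitely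
-- many terms of x can vanish.
recip : ℚ → ℚ
recip q with q ℚ.≟ 0ℚ
... | yes _   = 0ℚ
... | no q≢0 = (ℚ.1/ q) {{ℚ.≢-nonZero q≢0}}

∣∣-positive : ∀ x → x # 0ℝ →
  Σ ℚ λ δ → 0ℚ ℚ.< δ × Σ ℕ λ N → ∀ {n} → N ℕ.≤ n → δ ℚ.≤ ℚ.∣ seq x n ∣
∣∣-positive x (inj₁ (mk< δ 0<δ N x+δ≤0)) = δ , 0<δ , N , λ {n} N≤n →
  subst (δ ℚ.≤_) (ℚ.∣-p∣≡∣p∣ (seq x n))
    (ℚ.≤-trans (δ≤-x (x+δ≤0 N≤n)) (p≤∣p∣ (ℚ.- seq x n)))
  where
  open +-*-Solver
  δ≤-x : ∀ {q} → q ℚ.+ δ ℚ.≤ 0ℚ → δ ℚ.≤ ℚ.- q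
  δ≤-x {q} q+δ≤0 = subst₂ ℚ._≤_
    (solve 2 (λ q d → :- q :+ (q :+ d) := d) refl q δ) (ℚ.+-identityʳ (ℚ.- q))
    (ℚ.+-monoʳ-≤ (ℚ.- q) q+δ≤0)
∣∣-positive x (inj₂ (mk< δ 0<δ N 0+δ≤x)) = δ , 0<δ , N , λ {n} N≤n →
  ℚ.≤-trans (subst (ℚ._≤ seq x n) (ℚ.+-identityˡ δ) (0+δ≤x N≤n)) (p≤∣p∣ (seq x n))

recip-lipschitz : ∀ {δ p q} → 0ℚ ℚ.< δ → δ ℚ.≤ ℚ.∣ p ∣ → δ ℚ.≤ ℚ.∣ q ∣ →
  (δ ℚ.* δ) ℚ.* ℚ.∣ recip p ℚ.- recip q ∣ ℚ.≤ ℚ.∣ p ℚ.- q ∣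
recip-lipschitz {δ} {p} {q} 0<δ δ≤p δ≤q with p ℚ.≟ 0ℚ | q ℚ.≟ 0ℚ
... | yes refl | _        = contradiction (ℚ.<-≤-trans 0<δ δ≤p) (ℚ.<-irrefl refl)
... | no _     | yes refl = contradiction (ℚ.<-≤-trans 0<δ δ≤q) (ℚ.<-irrefl refl)
... | no p≢0   | no q≢0   = begin
  (δ ℚ.* δ) ℚ.* ℚ.∣ i ℚ.- j ∣                ≤⟨ ℚ.*-monoʳ-≤-nonNeg ℚ.∣ i ℚ.- j ∣ {{ℚ.∣-∣-nonNeg (i ℚ.- j)}}
                                                (*-mono-≤ (ℚ.0≤∣p∣ p) (ℚ.<⇒≤ 0<δ) δ≤p δ≤q) ⟩
  (ℚ.∣ p ∣ ℚ.* ℚ.∣ q ∣) ℚ.* ℚ.∣ i ℚ.- j ∣    ≡⟨ cong (ℚ._* ℚ.∣ i ℚ.- j ∣) (ℚ.∣p*q∣≡∣p∣*∣q∣ p q) ⟨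
  ℚ.∣ p ℚ.* q ∣ ℚ.* ℚ.∣ i ℚ.- j ∣            ≡⟨ ℚ.∣p*q∣≡∣p∣*∣q∣ (p ℚ.* q) (i ℚ.- j) ⟨
  ℚ.∣ (p ℚ.* q) ℚ.* (i ℚ.- j) ∣              ≡⟨ cong ℚ.∣_∣ (solve 4 (λ p q i j →
                                                (p :* q) :* (i :- j) := (p :* i) :* q :- (q :* j) :* p) refl p q i j) ⟩
  ℚ.∣ (p ℚ.* i) ℚ.* q ℚ.- (q ℚ.* j) ℚ.* p ∣  ≡⟨ cong₂ (λ u v → ℚ.∣ u ℚ.* q ℚ.- v ℚ.* p ∣)
                                                (ℚ.*-inverseʳ p) (ℚ.*-inverseʳ q) ⟩
  ℚ.∣ 1ℚ ℚ.* q ℚ.- 1ℚ ℚ.* p ∣                ≡⟨ cong₂ (λ u v → ℚ.∣ u ℚ.- v ∣)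
                                                (ℚ.*-identityˡ q) (ℚ.*-identityˡ p) ⟩
  ℚ.∣ q ℚ.- p ∣                              ≡⟨ ∣-∣-comm q p ⟩
  ℚ.∣ p ℚ.- q ∣                              ∎
  where
  open ℚ.≤-Reasoning
  open +-*-Solver
  instance
    p-nonZero = ℚ.≢-nonZero p≢0
    q-nonZero = ℚ.≢-nonZero q≢0
  i = ℚ.1/ p
  j = ℚ.1/ q

inv : (x : ℝ) → x # 0ℝ → ℝ
inv x x#0 = mkℝ (recip ∘ seq x) inv-cauchy
  where
  inv-cauchy : IsCauchy (recip ∘ seq x)
  inv-cauchy {ε} 0<ε with ∣∣-positive x x#0
  ... | δ , 0<δ , M , δ≤ with cauchy x (*-pos (*-pos 0<δ 0<δ) 0<ε)
  ... | N , close = M ℕ.⊔ N , λ m≥ n≥ → *-cancel-≤ (*-pos 0<δ 0<δ)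
    (ℚ.≤-trans
      (recip-lipschitz 0<δ (δ≤ (ℕ.m⊔n≤o⇒m≤o M N m≥)) (δ≤ (ℕ.m⊔n≤o⇒m≤o M N n≥)))
      (close (ℕ.m⊔n≤o⇒n≤o M N m≥) (ℕ.m⊔n≤o⇒n≤o M N n≥)))

term : ℚ → ℕ → ℚ
term q k = q ^ k ℚ.* (+ 1 / (k !)) {{k ℕ.!≢0}}

expSum : ℚ → ℕ → ℚ
expSum q zero    = term q zero
expSum q (suc n) = expSum q n ℚ.+ term q (suc n)

module Exp-Lemmas where
  open import Data.Rational.Base using () renaming
    (_+_ to _⊕_; _*_ to _⊗_; _-_ to _⊖_; ∣_∣ to ∥_∥; _≤_ to _≼_; _<_ to _≺_)
  open ℚ.≤-Reasoning
  open +-*-Solver using (solve; _:+_; _:*_; _:-_; :-_; _:=_; con)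

  1/! : ℕ → ℚ
  1/! k = (+ 1 / (k !)) {{k ℕ.!≢0}}

  0≤1/! : ∀ k → 0ℚ ≼ 1/! k
  0≤1/! k = 1/-nonNeg (k !) {{k ℕ.!≢0}}

  term-suc : ∀ q k → ι (suc k) ⊗ term q (suc k) ≡ term q k ⊗ q
  term-suc q k = begin-equality
    ι (suc k) ⊗ ((q ⊗ q ^ k) ⊗ 1/! (suc k))                ≡⟨ cong (λ r → ι (suc k) ⊗ ((q ⊗ q ^ k) ⊗ r))
                                                              (1/-* (suc k) (k !) {{_}} {{k ℕ.!≢0}} {{suc k ℕ.!≢0}}) ⟩
    ι (suc k) ⊗ ((q ⊗ q ^ k) ⊗ ((+ 1 / suc k) ⊗ 1/! k))    ≡⟨ solve 5 (λ n q p i f →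
                                                              n :* ((q :* p) :* (i :* f)) := (n :* i) :* ((p :* f) :* q))
                                                              refl (ι (suc k)) q (q ^ k) (+ 1 / suc k) (1/! k) ⟩
    (ι (suc k) ⊗ (+ 1 / suc k)) ⊗ (term q k ⊗ q)           ≡⟨ cong (_⊗ (term q k ⊗ q)) (ι-inverse (suc k)) ⟩
    1ℚ ⊗ (term q k ⊗ q)                                    ≡⟨ ℚ.*-identityˡ _ ⟩
    term q k ⊗ q                                           ∎

  ^-nonNeg : ∀ {q} → 0ℚ ≼ q → ∀ k → 0ℚ ≼ q ^ k
  ^-nonNeg 0≤q zero    = 0≤1
  ^-nonNeg 0≤q (suc k) = *-nonNeg 0≤q (^-nonNeg 0≤q k)

  ∥^∥≤ : ∀ {q B} → ∥ q ∥ ≼ B → ∀ k → ∥ q ^ k ∥ ≼ B ^ k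
  ∥^∥≤ q≤B zero        = ℚ.≤-refl
  ∥^∥≤ {q} q≤B (suc k) = ∣*∣-mono {q} q≤B (∥^∥≤ q≤B k)

  term-nonNeg : ∀ {q} → 0ℚ ≼ q → ∀ k → 0ℚ ≼ term q k
  term-nonNeg 0≤q k = *-nonNeg (^-nonNeg 0≤q k) (0≤1/! k)

  ∥term∥≤ : ∀ {q B} → ∥ q ∥ ≼ B → ∀ k → ∥ term q k ∥ ≼ term B k
  ∥term∥≤ {q} q≤B k =
    ∣*∣-mono {q ^ k} (∥^∥≤ q≤B k) (ℚ.≤-reflexive (ℚ.0≤p⇒∣p∣≡p (0≤1/! k)))

  expSum-mono : ∀ {K} → 0ℚ ≼ K → ∀ n j → expSum K n ≼ expSum K (j ℕ.+ n)
  expSum-mono 0≤K n zero        = ℚ.≤-refl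
  expSum-mono {K} 0≤K n (suc j) = begin
    expSum K n                                   ≤⟨ expSum-mono 0≤K n j ⟩
    expSum K (j ℕ.+ n)                           ≡⟨ ℚ.+-identityʳ _ ⟨
    expSum K (j ℕ.+ n) ⊕ 0ℚ                      ≤⟨ ℚ.+-monoʳ-≤ (expSum K (j ℕ.+ n)) (term-nonNeg 0≤K (suc j ℕ.+ n)) ⟩
    expSum K (suc j ℕ.+ n)                       ∎

  expSum-diff : ∀ {q K} → ∥ q ∥ ≼ K → ∀ n j →
    ∥ expSum q (j ℕ.+ n) ⊖ expSum q n ∥ ≼ expSum K (j ℕ.+ n) ⊖ expSum K n
  expSum-diff {q} {K} q≤K n zero = ℚ.≤-reflexive (begin-equality
    ∥ expSum q n ⊖ expSum q n ∥  ≡⟨ cong ∥_∥ (ℚ.+-inverseʳ (expSum q n)) ⟩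
    0ℚ                           ≡⟨ ℚ.+-inverseʳ (expSum K n) ⟨
    expSum K n ⊖ expSum K n      ∎)
  expSum-diff {q} {K} q≤K n (suc j) = subst₂ _≼_
    (cong ∥_∥ (swap (expSum q (j ℕ.+ n)) (expSum q n) (term q (suc j ℕ.+ n))))
    (swap (expSum K (j ℕ.+ n)) (expSum K n) (term K (suc j ℕ.+ n)))
    (∣+∣-mono (expSum-diff q≤K n j) (∥term∥≤ q≤K (suc j ℕ.+ n)))
    where
    swap : ∀ a b c → (a ⊖ b) ⊕ c ≡ (a ⊕ c) ⊖ b
    swap = solve 3 (λ a b c → (a :- b) :+ c := (a :+ c) :- b) refl

  -- a^(k+1) - b^(k+1) = a (a^k - b^k) + (a - b) b^k
  ^-lipschitz : ∀ {a b B} → 0ℚ ≼ B → ∥ a ∥ ≼ B → ∥ b ∥ ≼ B → ∀ k →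
    ∥ a ^ k ⊖ b ^ k ∥ ≼ ∥ a ⊖ b ∥ ⊗ (B ⊕ 1ℚ) ^ k
  ^-lipschitz {a} {b} {B} 0≤B a≤B b≤B zero = *-nonNeg (ℚ.0≤∣p∣ (a ⊖ b)) 0≤1
  ^-lipschitz {a} {b} {B} 0≤B a≤B b≤B (suc k) = begin
    ∥ a ⊗ a ^ k ⊖ b ⊗ b ^ k ∥                  ≡⟨ cong ∥_∥ (solve 4 (λ a b p r →
                                                  a :* p :- b :* r := a :* (p :- r) :+ (a :- b) :* r)
                                                  refl a b (a ^ k) (b ^ k)) ⟩
    ∥ a ⊗ (a ^ k ⊖ b ^ k) ⊕ (a ⊖ b) ⊗ b ^ k ∥  ≤⟨ ∣+∣-mono
                                                  (∣*∣-mono {a} a≤B (^-lipschitz 0≤B a≤B b≤B k))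
                                                  (∣*∣-mono {a ⊖ b} ℚ.≤-refl (∥^∥≤ (ℚ.≤-trans b≤B B≤K) k)) ⟩
    B ⊗ (D ⊗ K ^ k) ⊕ D ⊗ K ^ k                ≡⟨ cong (B ⊗ (D ⊗ K ^ k) ⊕_) (ℚ.*-identityˡ (D ⊗ K ^ k)) ⟨
    B ⊗ (D ⊗ K ^ k) ⊕ 1ℚ ⊗ (D ⊗ K ^ k)         ≡⟨ solve 4 (λ b d p e → b :* (d :* p) :+ e :* (d :* p)
                                                  := d :* ((b :+ e) :* p)) refl B D (K ^ k) 1ℚ ⟩
    D ⊗ (K ⊗ K ^ k)                            ∎
    where
    D = ∥ a ⊖ b ∥
    K = B ⊕ 1ℚ
    B≤K : B ≼ K
    B≤K = subst (_≼ K) (ℚ.+-identityʳ B) (ℚ.+-monoʳ-≤ B 0≤1)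

  expSum-lipschitz : ∀ {a b B} → 0ℚ ≼ B → ∥ a ∥ ≼ B → ∥ b ∥ ≼ B → ∀ n →
    ∥ expSum a n ⊖ expSum b n ∥ ≼ ∥ a ⊖ b ∥ ⊗ expSum (B ⊕ 1ℚ) n
  expSum-lipschitz {a} {b} {B} 0≤B a≤B b≤B = go
    where
    D = ∥ a ⊖ b ∥
    K = B ⊕ 1ℚ
    term-lipschitz : ∀ k → ∥ term a k ⊖ term b k ∥ ≼ D ⊗ term K k
    term-lipschitz k = subst₂ _≼_
      (cong ∥_∥ (solve 3 (λ a b f → (a :- b) :* f := a :* f :- b :* f) refl (a ^ k) (b ^ k) (1/! k)))
      (ℚ.*-assoc D (K ^ k) (1/! k))
      (∣*∣-mono {a ^ k ⊖ b ^ k} (^-lipschitz 0≤B a≤B b≤B k)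
        (ℚ.≤-reflexive (ℚ.0≤p⇒∣p∣≡p (0≤1/! k))))
    go : ∀ n → ∥ expSum a n ⊖ expSum b n ∥ ≼ D ⊗ expSum K n
    go zero    = term-lipschitz zero
    go (suc n) = subst₂ _≼_
      (cong ∥_∥ (solve 4 (λ a b c d → (a :- b) :+ (c :- d) := (a :+ c) :- (b :+ d)) refl
        (expSum a n) (expSum b n) (term a (suc n)) (term b (suc n))))
      (sym (ℚ.*-distribˡ-+ D (expSum K n) (term K (suc n))))
      (∣+∣-mono (go n) (term-lipschitz (suc n)))

  module Tail {K} (0<K : 0ℚ ≺ K) where
    0≤K : 0ℚ ≼ K
    0≤K = ℚ.<⇒≤ 0<K

    N₀ : ℕ
    N₀ = proj₁ (archimedean (K ⊕ K))

    term-halves : ∀ {k} → N₀ ℕ.≤ k → term K (suc k) ⊕ term K (suc k) ≼ term K k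
    term-halves {k} N₀≤k = *-cancel-≤ {K} {t′ ⊕ t′} {term K k} 0<K (begin
      K ⊗ (t′ ⊕ t′)    ≡⟨ solve 2 (λ k t → k :* (t :+ t) := (k :+ k) :* t) refl K t′ ⟩
      (K ⊕ K) ⊗ t′     ≤⟨ ℚ.*-monoʳ-≤-nonNeg t′ {{ℚ.nonNegative (term-nonNeg 0≤K (suc k))}}
                          (ℚ.≤-trans (proj₂ (archimedean (K ⊕ K))) (ι-mono {N₀} {suc k} (ℕ.m≤n⇒m≤1+n N₀≤k))) ⟩
      ι (suc k) ⊗ t′   ≡⟨ term-suc K k ⟩
      term K k ⊗ K     ≡⟨ ℚ.*-comm (term K k) K ⟩
      K ⊗ term K k     ∎)
      where t′ = term K (suc k)

    expSum-nonNeg : ∀ n → 0ℚ ≼ expSum K n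
    expSum-nonNeg zero    = term-nonNeg 0≤K 0
    expSum-nonNeg (suc n) = ℚ.+-mono-≤ (expSum-nonNeg n) (term-nonNeg 0≤K (suc n))

    -- The tail after n is at most the n-th term.
    tail≤ : ∀ {n} → N₀ ℕ.≤ n → ∀ j →
      expSum K (j ℕ.+ n) ⊕ term K (j ℕ.+ n) ≼ expSum K n ⊕ term K n
    tail≤ N₀≤n zero = ℚ.≤-refl
    tail≤ {n} N₀≤n (suc j) = begin
      (expSum K (j ℕ.+ n) ⊕ t′) ⊕ t′          ≡⟨ ℚ.+-assoc (expSum K (j ℕ.+ n)) t′ t′ ⟩
      expSum K (j ℕ.+ n) ⊕ (t′ ⊕ t′)          ≤⟨ ℚ.+-monoʳ-≤ (expSum K (j ℕ.+ n))
                                                 (term-halves (ℕ.≤-trans N₀≤n (ℕ.m≤n+m n j))) ⟩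
      expSum K (j ℕ.+ n) ⊕ term K (j ℕ.+ n)   ≤⟨ tail≤ N₀≤n j ⟩
      expSum K n ⊕ term K n                   ∎
      where t′ = term K (suc j ℕ.+ n)

    expSum-tail : ∀ {n} → N₀ ℕ.≤ n → ∀ j → expSum K (j ℕ.+ n) ⊖ expSum K n ≼ term K n
    expSum-tail {n} N₀≤n j = begin
      S′ ⊖ S                  ≡⟨ cong (_⊖ S) (ℚ.+-identityʳ S′) ⟨
      (S′ ⊕ 0ℚ) ⊖ S           ≤⟨ ℚ.+-monoˡ-≤ (ℚ.- S) (ℚ.+-monoʳ-≤ S′ (term-nonNeg 0≤K (j ℕ.+ n))) ⟩
      (S′ ⊕ term K (j ℕ.+ n)) ⊖ S  ≤⟨ ℚ.+-monoˡ-≤ (ℚ.- S) (tail≤ N₀≤n j) ⟩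
      (S ⊕ term K n) ⊖ S      ≡⟨ solve 2 (λ s t → (s :+ t) :- s := t) refl S (term K n) ⟩
      term K n                ∎
      where
      S  = expSum K n
      S′ = expSum K (j ℕ.+ n)

    term-decreasing : ∀ {n} → N₀ ℕ.≤ n → ∀ j → term K (j ℕ.+ n) ≼ term K n
    term-decreasing N₀≤n zero = ℚ.≤-refl
    term-decreasing {n} N₀≤n (suc j) = begin
      t′              ≡⟨ ℚ.+-identityʳ t′ ⟨
      t′ ⊕ 0ℚ         ≤⟨ ℚ.+-monoʳ-≤ t′ (term-nonNeg 0≤K (suc j ℕ.+ n)) ⟩
      t′ ⊕ t′         ≤⟨ term-halves (ℕ.≤-trans N₀≤n (ℕ.m≤n+m n j)) ⟩
      term K (j ℕ.+ n) ≤⟨ term-decreasing N₀≤n j ⟩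
      term K n        ∎
      where t′ = term K (suc j ℕ.+ n)

    C : ℚ
    C = term K N₀ ⊗ K

    -- (k+1) K^(k+1)/(k+1)! = K · K^k/k! is bounded, so the terms tend to 0.
    term-small : ∀ {ε} → 0ℚ ≺ ε → Σ ℕ λ N → N₀ ℕ.≤ N × term K N ≼ ε
    term-small {ε} 0<ε with scale 0<ε 0<1
    ... | δ , 0<δ , εδ≡1 with archimedean (C ⊗ δ)
    ... | M , Cδ≤M = suc k , ℕ.m≤n⇒m≤1+n (ℕ.m≤n+m N₀ M) ,
      *-cancel-≤ {ι (suc k)} {term K (suc k)} {ε} 0<ι (begin
        ι (suc k) ⊗ term K (suc k)   ≡⟨ term-suc K k ⟩
        term K k ⊗ K                 ≤⟨ ℚ.*-monoʳ-≤-nonNeg K {{ℚ.nonNegative 0≤K}}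
                                        (term-decreasing {N₀} ℕ.≤-refl M) ⟩
        C                            ≡⟨ ℚ.*-identityʳ C ⟨
        C ⊗ 1ℚ                       ≡⟨ cong (C ⊗_) εδ≡1 ⟨
        C ⊗ (ε ⊗ δ)                  ≡⟨ solve 3 (λ c e d → c :* (e :* d) := (c :* d) :* e) refl C ε δ ⟩
        (C ⊗ δ) ⊗ ε                  ≤⟨ ℚ.*-monoʳ-≤-nonNeg ε {{ℚ.nonNegative (ℚ.<⇒≤ 0<ε)}}
                                        (ℚ.≤-trans Cδ≤M (ι-mono {M} {suc k} (ℕ.m≤n⇒m≤1+n (ℕ.m≤m+n M N₀)))) ⟩
        ι (suc k) ⊗ ε                ∎)
      where
      k = M ℕ.+ N₀
      0<ι : 0ℚ ≺ ι (suc k)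
      0<ι = ℚ.<-≤-trans 0<1 (ι-mono {1} {suc k} (s≤s z≤n))

    expSum-bound : Σ ℚ λ A → 0ℚ ≺ A × ∀ {n} → N₀ ℕ.≤ n → expSum K n ≼ A
    expSum-bound = A ⊕ 1ℚ , ℚ.+-mono-≤-< 0≤A 0<1 , λ {n} N₀≤n → begin
      expSum K n                    ≡⟨ cong (expSum K) (ℕ.m∸n+n≡m N₀≤n) ⟨
      expSum K (n ℕ.∸ N₀ ℕ.+ N₀)    ≡⟨ ℚ.+-identityʳ _ ⟨
      expSum K (n ℕ.∸ N₀ ℕ.+ N₀) ⊕ 0ℚ
                                    ≤⟨ ℚ.+-monoʳ-≤ (expSum K (n ℕ.∸ N₀ ℕ.+ N₀)) (term-nonNeg 0≤K (n ℕ.∸ N₀ ℕ.+ N₀)) ⟩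
      expSum K (n ℕ.∸ N₀ ℕ.+ N₀) ⊕ term K (n ℕ.∸ N₀ ℕ.+ N₀)
                                    ≤⟨ tail≤ ℕ.≤-refl (n ℕ.∸ N₀) ⟩
      A                             ≡⟨ ℚ.+-identityʳ A ⟨
      A ⊕ 0ℚ                        ≤⟨ ℚ.+-monoʳ-≤ A 0≤1 ⟩
      A ⊕ 1ℚ                        ∎
      where
      A = expSum K N₀ ⊕ term K N₀
      0≤A : 0ℚ ≼ A
      0≤A = ℚ.+-mono-≤ (expSum-nonNeg N₀) (term-nonNeg 0≤K N₀)

    expSum-near : ∀ {N n ε q} → ∥ q ∥ ≼ K → N₀ ℕ.≤ N → term K N ≼ ε → N ℕ.≤ n →
      ∥ expSum q n ⊖ expSum q N ∥ ≼ ε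
    expSum-near {N} {n} {ε} {q} q≤K N₀≤N t≤ε N≤n =
      subst (λ m → ∥ expSum q m ⊖ expSum q N ∥ ≼ ε) (ℕ.m∸n+n≡m N≤n)
        (ℚ.≤-trans (expSum-diff q≤K N (n ℕ.∸ N)) (ℚ.≤-trans (expSum-tail N₀≤N (n ℕ.∸ N)) t≤ε))

  module Diagonal {B} (0<B : 0ℚ ≺ B) where
    K : ℚ
    K = B ⊕ 1ℚ

    0≤B : 0ℚ ≼ B
    0≤B = ℚ.<⇒≤ 0<B

    B≤K : B ≼ K
    B≤K = subst (_≼ K) (ℚ.+-identityʳ B) (ℚ.+-monoʳ-≤ B 0≤1)

    open Tail (ℚ.<-≤-trans 0<B B≤K) public

    -- S_m(a) ~ S_P(a) ~ S_P(b) ~ S_n(b), by the tail estimate, the Lipschitz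
    -- estimate, and the tail estimate.
    diagonal : ∀ {A P η δ} → N₀ ℕ.≤ P → term K P ≼ η → expSum K P ≼ A → 0ℚ ≼ δ →
      ∀ {a b m n} → ∥ a ∥ ≼ B → ∥ b ∥ ≼ B → P ℕ.≤ m → P ℕ.≤ n → ∥ a ⊖ b ∥ ≼ δ →
      ∥ expSum a m ⊖ expSum b n ∥ ≼ η ⊕ (δ ⊗ A ⊕ η)
    diagonal {A} {P} {η} {δ} N₀≤P t≤η S≤A 0≤δ {a} {b} {m} {n} a≤B b≤B P≤m P≤n ab≤δ = begin
      ∥ s₁ ⊖ s₄ ∥                                ≤⟨ triangle s₁ s₂ s₄ ⟩
      ∥ s₁ ⊖ s₂ ∥ ⊕ ∥ s₂ ⊖ s₄ ∥                  ≤⟨ ℚ.+-monoʳ-≤ ∥ s₁ ⊖ s₂ ∥ (triangle s₂ s₃ s₄) ⟩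
      ∥ s₁ ⊖ s₂ ∥ ⊕ (∥ s₂ ⊖ s₃ ∥ ⊕ ∥ s₃ ⊖ s₄ ∥)  ≤⟨ ℚ.+-mono-≤ near₁ (ℚ.+-mono-≤ near₂ near₃) ⟩
      η ⊕ (δ ⊗ A ⊕ η)                            ∎
      where
      s₁ = expSum a m
      s₂ = expSum a P
      s₃ = expSum b P
      s₄ = expSum b n
      near₁ : ∥ s₁ ⊖ s₂ ∥ ≼ η
      near₁ = expSum-near {P} {m} {η} {a} (ℚ.≤-trans a≤B B≤K) N₀≤P t≤η P≤m
      near₂ : ∥ s₂ ⊖ s₃ ∥ ≼ δ ⊗ A
      near₂ = ℚ.≤-trans (expSum-lipschitz {a} {b} {B} 0≤B a≤B b≤B P)
        (*-mono-≤ {∥ a ⊖ b ∥} {δ} {expSum K P} {A} 0≤δ (expSum-nonNeg P) ab≤δ S≤A)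
      near₃ : ∥ s₃ ⊖ s₄ ∥ ≼ η
      near₃ = subst (_≼ η) (∣-∣-comm s₄ s₃)
        (expSum-near {P} {n} {η} {b} (ℚ.≤-trans b≤B B≤K) N₀≤P t≤η P≤n)

  quarters : ∀ ε {z} → z ≡ ε ⊗ ½ → (ε ⊗ ½) ⊗ ½ ⊕ (z ⊕ (ε ⊗ ½) ⊗ ½) ≡ ε
  quarters ε refl = begin-equality
    q ⊕ (h ⊕ q)  ≡⟨ solve 2 (λ q h → q :+ (h :+ q) := (q :+ q) :+ h) refl q h ⟩
    (q ⊕ q) ⊕ h  ≡⟨ cong (_⊕ h) (half+half h) ⟩
    h ⊕ h        ≡⟨ half+half ε ⟩
    ε            ∎
    where
    h = ε ⊗ ½
    q = h ⊗ ½

  exp-cauchy : ∀ x → IsCauchy (λ n → expSum (seq x n) n)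
  exp-cauchy x {ε} 0<ε =
    let B , 0<B , M , x≤B       = bounded x
        open Diagonal 0<B
        P , N₀≤P , t≤           = term-small (0<half (0<half 0<ε))
        A , 0<A , S≤A           = expSum-bound
        δ , 0<δ , Aδ≡           = scale {A} {ε ⊗ ½} 0<A (0<half 0<ε)
        Q , close               = cauchy x 0<δ
    in (M ℕ.⊔ P) ℕ.⊔ Q , λ {m} {n} m≥ n≥ →
      let m≥₁ = ℕ.m⊔n≤o⇒m≤o (M ℕ.⊔ P) Q m≥
          n≥₁ = ℕ.m⊔n≤o⇒m≤o (M ℕ.⊔ P) Q n≥
      in subst (∥ expSum (seq x m) m ⊖ expSum (seq x n) n ∥ ≼_)
        (quarters ε (trans (ℚ.*-comm δ A) Aδ≡))
        (diagonal {A} {P} {(ε ⊗ ½) ⊗ ½} {δ} N₀≤P t≤ (S≤A N₀≤P) (ℚ.<⇒≤ 0<δ)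
          {seq x m} {seq x n} {m} {n}
          (x≤B (ℕ.m⊔n≤o⇒m≤o M P m≥₁)) (x≤B (ℕ.m⊔n≤o⇒m≤o M P n≥₁))
          (ℕ.m⊔n≤o⇒n≤o M P m≥₁) (ℕ.m⊔n≤o⇒n≤o M P n≥₁)
          (close (ℕ.m⊔n≤o⇒n≤o (M ℕ.⊔ P) Q m≥) (ℕ.m⊔n≤o⇒n≤o (M ℕ.⊔ P) Q n≥)))

-- The series Σ x^k / k! converges locally uniformly, so the diagonal sequence
-- S_n(x_n) of its partial sums converges to e^x.
exp : ℝ → ℝ
exp x = mkℝ (λ n → expSum (seq x n) n) (Exp-Lemmas.exp-cauchy x)

-- Coefficients a₀ ∷ a₁ ∷ … ∷ a_d ∷ []
record Polynomial (d : ℕ) : Set where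
  constructor mkPolynomial
  field
    coefficients : Vec ℝ (suc d)
    leading≉0    : last coefficients ≉ 0ℝ

open Polynomial public

horner : ∀ {n} → Vec ℝ n → ℝ → ℝ
horner []       x = 0ℝ
horner (a ∷ as) x = a + x * horner as x

⟦_⟧ : ∀ {d} → Polynomial d → ℝ → ℝ
⟦ p ⟧ = horner (coefficients p)

-- An extended real, given by its set of real upper bounds (+∞ has none).
-- This lets every family of reals have a supremum.
Extended : Set₁
Extended = ℝ → Set

sup : {I : Set} → (I → ℝ) → Extended
sup f M = ∀ i → f i ≤ M

infix 4 _≤ᵉ_

_≤ᵉ_ : ℝ → Extended → Set
c ≤ᵉ s = ∀ M → s M → c ≤ M

-- The points of [0,∞) at which 1/p(x) is defined. Near a zero of p the
-- reciprocal is unbounded, so leaving zeros out does not change a supremum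
-- that counts 1/0 as infinite.
record Point {d} (p : Polynomial d) : Set where
  constructor mkPoint
  field
    x    : ℝ
    0≤x  : 0ℝ ≤ x
    px#0 : ⟦ p ⟧ x # 0ℝ

error : ∀ {d} (p : Polynomial d) → Point p → ℝ
error p (mkPoint x _ px#0) = ∣ exp (- x) - inv (⟦ p ⟧ x) px#0 ∣

{-# OPTIONS --safe #-}

-- Suppose the error is at most ε < 50⁻ᵈ. At the integers k ≤ d + 1 the value
-- e⁻ᵏ ≥ 3⁻ᵏ is much larger than ε, so p(k) differs from eᵏ by at most a
-- multiple of ε·e²ᵏ ≤ ε·9ᵏ. The (d+1)-st difference annihilates p and sends eᵏ
-- to (e - 1)ᵈ⁺¹ ≥ 1, so 1 is at most a multiple of ε·10ᵈ⁺¹, which is absurd for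
-- large d. All estimates are made on the rational approximations with a large
-- common index n; eᵏ becomes a power of the reciprocal of the n-th partial sum
-- for e⁻¹. The goal c ≤ M is stable under double negation, which allows
-- assuming M < c and p(k) ≠ 0.
module Submission where

open import Defs
open import Algebra.Bundles using (module CommutativeRing)
open import Data.Nat.Base as ℕ using (ℕ; zero; suc; z≤n; s≤s)
import Data.Nat.Properties as ℕ
open import Data.Integer.Base as ℤ using (+_)
import Data.Integer.Properties as ℤ
open import Data.Product.Base using (Σ; _×_; _,_; proj₁; proj₂)
open import Data.Rational.Base as ℚ using (ℚ; 0ℚ; 1ℚ; ½; _/_) renaming
  (_+_ to _⊕_; _*_ to _⊗_; _-_ to _⊖_; ∣_∣ to ∥_∥; _≤_ to _≼_; _<_ to _≺_)
import Data.Rational.Properties as ℚ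
open import Data.Rational.Solver using (module +-*-Solver)
open import Data.Rational.Unnormalised.Base as ℚᵘ using (mkℚᵘ; *≡*)
import Data.Rational.Unnormalised.Properties as ℚᵘ
open import Data.Sum.Base using (inj₁; inj₂)
open import Data.Vec.Base using (Vec; []; _∷_; last)
open import Function.Base using (_∘_)
open import Relation.Binary.PropositionalEquality
open import Relation.Nullary using (¬_; yes; no; contradiction)
open import Relation.Nullary.Decidable using (from-yes)
open import Algebra.Properties.CommutativeSemiring.Exp
  (CommutativeRing.commutativeSemiring ℚ.+-*-commutativeRing) using (^-distrib-*)

open ℚ-Lemmas
open Exp-Lemmas
open +-*-Solver using (solve; _:+_; _:*_; _:-_; :-_; _:=_; con)

-- The error is only defined where `p` is apart from 0, and `sup` ranges over such points alone, so
-- a bound on the error says nothing directly at a given integer. What rules out a zero at x₀ is the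
-- degree: near such a point `p` would be small, while the error bound keeps 1/p bounded wherever it
-- exists, so `p` could not be apart from 0 at any of d + 1 close nodes. Their d-th difference is d!
-- hᵈ times the leading coefficient, contradicting `leading≉0`.
--
-- At a fixed index `n` the values of `p` are exact values of one rational polynomial, so its
-- differences vanish identically and not merely in the limit. The price is that the partial sum at
-- -k is only close to the k-th power of the partial sum at -1; hence the quantitative functional
-- equation for partial sums.
--
-- The base 10 is 3² + 1: the bound 3 on the reciprocal enters squared, and differencing adds 1 to
-- the growth rate. The base 50 exceeds it by a factor 5, whose powers absorb the remaining
-- constants.

ι-suc : ∀ k → ι (suc k) ≡ ι k ⊕ 1ℚ
ι-suc k = ℚ.toℚᵘ-injective (begin
  ℚ.toℚᵘ (ι (suc k))          ≈⟨ /-normal (+ suc k) 0 ⟩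
  mkℚᵘ (+ suc k) 0            ≈⟨ *≡* (cong (ℤ._* + 1) (trans (cong +_ (ℕ.+-comm 1 k))
                                   (cong (ℤ._+ + 1) (sym (ℤ.*-identityʳ (+ k)))))) ⟩
  mkℚᵘ (+ k) 0 ℚᵘ.+ ℚᵘ.1ℚᵘ    ≈⟨ ℚᵘ.+-cong (/-normal (+ k) 0) (ℚᵘ.≃-refl {ℚᵘ.1ℚᵘ}) ⟨
  ℚ.toℚᵘ (ι k) ℚᵘ.+ ℚᵘ.1ℚᵘ    ≈⟨ ℚ.toℚᵘ-homo-+ (ι k) 1ℚ ⟨
  ℚ.toℚᵘ (ι k ⊕ 1ℚ)           ∎)
  where open ℚᵘ.≃-Reasoning

open ℚ.≤-Reasoning

0≤ι : ∀ k → 0ℚ ≼ ι k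
0≤ι k = ι-mono {0} {k} z≤n

-- Finite differences

Δ : ℕ → (ℕ → ℚ) → ℕ → ℚ
Δ zero    f k = f k
Δ (suc m) f k = Δ m f (suc k) ⊖ Δ m f k

Δ-cong : ∀ {f g} → (∀ k → f k ≡ g k) → ∀ m k → Δ m f k ≡ Δ m g k
Δ-cong f≡g zero    k = f≡g k
Δ-cong f≡g (suc m) k = cong₂ _⊖_ (Δ-cong f≡g m (suc k)) (Δ-cong f≡g m k)

Δ-+ : ∀ f g m k → Δ m (λ j → f j ⊕ g j) k ≡ Δ m f k ⊕ Δ m g k
Δ-+ f g zero    k = refl
Δ-+ f g (suc m) k = trans
  (cong₂ _⊖_ (Δ-+ f g m (suc k)) (Δ-+ f g m k))
  (solve 4 (λ a b c d → (a :+ b) :- (c :+ d) := (a :- c) :+ (b :- d)) refl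
    (Δ m f (suc k)) (Δ m g (suc k)) (Δ m f k) (Δ m g k))

Δ-const : ∀ a m k → Δ (suc m) (λ _ → a) k ≡ 0ℚ
Δ-const a zero    k = ℚ.+-inverseʳ a
Δ-const a (suc m) k = cong₂ _⊖_ (Δ-const a m (suc k)) (Δ-const a m k)

-- The Leibniz rule for differences keeps only two terms here, because `u` is affine and its
-- differences beyond the first one vanish.
Δ-leibniz : ∀ h (u : ℕ → ℚ) → (∀ k → u (suc k) ≡ u k ⊕ h) → ∀ f m k →
  Δ (suc m) (λ j → u j ⊗ f j) k ≡ u k ⊗ Δ (suc m) f k ⊕ (ι (suc m) ⊗ h) ⊗ Δ m f (suc k)
Δ-leibniz h u step f zero k = begin-equality
  u (suc k) ⊗ f (suc k) ⊖ u k ⊗ f k    ≡⟨ cong (λ v → v ⊗ f (suc k) ⊖ u k ⊗ f k) (step k) ⟩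
  (u k ⊕ h) ⊗ f (suc k) ⊖ u k ⊗ f k    ≡⟨ solve 4 (λ u h f g →
                                          (u :+ h) :* g :- u :* f := u :* (g :- f) :+ (con 1ℚ :* h) :* g)
                                          refl (u k) h (f k) (f (suc k)) ⟩
  u k ⊗ (f (suc k) ⊖ f k) ⊕ (1ℚ ⊗ h) ⊗ f (suc k) ∎
Δ-leibniz h u step f (suc m) k = begin-equality
  Δ (suc m) (λ j → u j ⊗ f j) (suc k) ⊖ Δ (suc m) (λ j → u j ⊗ f j) k
    ≡⟨ cong₂ _⊖_ (Δ-leibniz h u step f m (suc k)) (Δ-leibniz h u step f m k) ⟩
  (u (suc k) ⊗ (z ⊖ y) ⊕ (ι (suc m) ⊗ h) ⊗ z) ⊖ (u k ⊗ (y ⊖ x) ⊕ (ι (suc m) ⊗ h) ⊗ y)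
    ≡⟨ cong (λ v → (v ⊗ (z ⊖ y) ⊕ (ι (suc m) ⊗ h) ⊗ z) ⊖ (u k ⊗ (y ⊖ x) ⊕ (ι (suc m) ⊗ h) ⊗ y)) (step k) ⟩
  ((u k ⊕ h) ⊗ (z ⊖ y) ⊕ (ι (suc m) ⊗ h) ⊗ z) ⊖ (u k ⊗ (y ⊖ x) ⊕ (ι (suc m) ⊗ h) ⊗ y)
    ≡⟨ solve 6 (λ u h n x y z →
         ((u :+ h) :* (z :- y) :+ (n :* h) :* z) :- (u :* (y :- x) :+ (n :* h) :* y)
         := u :* ((z :- y) :- (y :- x)) :+ ((n :+ con 1ℚ) :* h) :* (z :- y))
         refl (u k) h (ι (suc m)) x y z ⟩
  u k ⊗ ((z ⊖ y) ⊖ (y ⊖ x)) ⊕ ((ι (suc m) ⊕ 1ℚ) ⊗ h) ⊗ (z ⊖ y)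
    ≡⟨ cong (λ n → u k ⊗ ((z ⊖ y) ⊖ (y ⊖ x)) ⊕ (n ⊗ h) ⊗ (z ⊖ y)) (ι-suc (suc m)) ⟨
  u k ⊗ ((z ⊖ y) ⊖ (y ⊖ x)) ⊕ (ι (suc (suc m)) ⊗ h) ⊗ (z ⊖ y) ∎
  where
  x = Δ m f k
  y = Δ m f (suc k)
  z = Δ m f (suc (suc k))

Δ-geometric : ∀ t m k → Δ m (t ^_) k ≡ (t ⊖ 1ℚ) ^ m ⊗ t ^ k
Δ-geometric t zero    k = sym (ℚ.*-identityˡ (t ^ k))
Δ-geometric t (suc m) k = trans
  (cong₂ _⊖_ (Δ-geometric t m (suc k)) (Δ-geometric t m k))
  (solve 3 (λ t s w → s :* (t :* w) :- s :* w := ((t :- con 1ℚ) :* s) :* w) refl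
    t ((t ⊖ 1ℚ) ^ m) (t ^ k))

-- Each difference costs a factor b + 1, since bᵏ⁺¹ + bᵏ = (b + 1) bᵏ. The range is capped at `K`
-- because only finitely many values are controlled.
∥Δ∥≤ : ∀ A b f {K} → (∀ {k} → k ℕ.≤ K → ∥ f k ∥ ≼ A ⊗ b ^ k) →
  ∀ m {k} → m ℕ.+ k ℕ.≤ K → ∥ Δ m f k ∥ ≼ (A ⊗ (b ⊕ 1ℚ) ^ m) ⊗ b ^ k
∥Δ∥≤ A b f f≤ zero {k} k≤K =
  subst (λ B → ∥ f k ∥ ≼ B ⊗ b ^ k) (sym (ℚ.*-identityʳ A)) (f≤ k≤K)
∥Δ∥≤ A b f {K} f≤ (suc m) {k} m+k<K = begin
  ∥ Δ m f (suc k) ⊖ Δ m f k ∥                    ≤⟨ ∣+∣-mono {Δ m f (suc k)}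
                                                    (∥Δ∥≤ A b f f≤ m (subst (ℕ._≤ K) (sym (ℕ.+-suc m k)) m+k<K))
                                                    (subst (_≼ C ⊗ b ^ k) (sym (ℚ.∣-p∣≡∣p∣ (Δ m f k)))
                                                      (∥Δ∥≤ A b f f≤ m (ℕ.<⇒≤ m+k<K))) ⟩
  C ⊗ (b ⊗ b ^ k) ⊕ C ⊗ b ^ k                    ≡⟨ solve 4 (λ a b s w →
                                                    (a :* s) :* (b :* w) :+ (a :* s) :* w :=
                                                    (a :* ((b :+ con 1ℚ) :* s)) :* w)
                                                    refl A b ((b ⊕ 1ℚ) ^ m) (b ^ k) ⟩
  (A ⊗ ((b ⊕ 1ℚ) ⊗ (b ⊕ 1ℚ) ^ m)) ⊗ b ^ k        ∎
  where C = A ⊗ (b ⊕ 1ℚ) ^ m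

-- By computation this is the exact Horner value of the rational polynomial whose coefficients are
-- the `n`-th approximations of `as`.
evalAt : ∀ {m} → Vec ℝ m → ℕ → ℚ → ℚ
evalAt as n x = seq (horner as (fromℚ x)) n

-- This is m! hᵐ, the m-th difference of xᵐ for step `h`.
scaledFactorial : ℚ → ℕ → ℚ
scaledFactorial h zero    = 1ℚ
scaledFactorial h (suc m) = (ι (suc m) ⊗ h) ⊗ scaledFactorial h m

scaledFactorial-pos : ∀ {h} → 0ℚ ≺ h → ∀ m → 0ℚ ≺ scaledFactorial h m
scaledFactorial-pos 0<h zero    = 0<1
scaledFactorial-pos 0<h (suc m) = *-pos
  (*-pos (ℚ.<-≤-trans 0<1 (ι-mono {1} {suc m} (s≤s z≤n))) 0<h) (scaledFactorial-pos 0<h m)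

module _ (x₀ h : ℚ) where
  node : ℕ → ℚ
  node k = x₀ ⊕ ι k ⊗ h

  node-suc : ∀ k → node (suc k) ≡ node k ⊕ h
  node-suc k = trans (cong (λ i → x₀ ⊕ i ⊗ h) (ι-suc k))
    (solve 3 (λ x i h → x :+ (i :+ con 1ℚ) :* h := (x :+ i :* h) :+ h) refl x₀ (ι k) h)

  samples : ∀ {m} → Vec ℝ m → ℕ → ℕ → ℚ
  samples as n k = evalAt as n (node k)

  Δ-samples-∷ : ∀ {l} a (as : Vec ℝ l) n m k → Δ (suc m) (samples (a ∷ as) n) k ≡
    node k ⊗ Δ (suc m) (samples as n) k ⊕ (ι (suc m) ⊗ h) ⊗ Δ m (samples as n) (suc k)
  Δ-samples-∷ a as n m k = begin-equality
    Δ (suc m) (samples (a ∷ as) n) k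
      ≡⟨ Δ-+ (λ _ → seq a n) (λ j → node j ⊗ samples as n j) (suc m) k ⟩
    Δ (suc m) (λ _ → seq a n) k ⊕ Δ (suc m) (λ j → node j ⊗ samples as n j) k
      ≡⟨ cong₂ _⊕_ (Δ-const (seq a n) m k) (Δ-leibniz h node node-suc (samples as n) m k) ⟩
    0ℚ ⊕ (node k ⊗ Δ (suc m) (samples as n) k ⊕ (ι (suc m) ⊗ h) ⊗ Δ m (samples as n) (suc k))
      ≡⟨ ℚ.+-identityˡ _ ⟩
    node k ⊗ Δ (suc m) (samples as n) k ⊕ (ι (suc m) ⊗ h) ⊗ Δ m (samples as n) (suc k) ∎

  -- A vector of length `m` has degree below `m`. The Leibniz rule removes one Horner step, and both
  -- remaining terms are built from `m`-th differences of the tail.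
  Δ-vanishes : ∀ {m} (as : Vec ℝ m) n k → Δ m (samples as n) k ≡ 0ℚ
  Δ-vanishes []                 n k = refl
  Δ-vanishes {suc m} (a ∷ as) n k = begin-equality
    Δ (suc m) (samples (a ∷ as) n) k  ≡⟨ Δ-samples-∷ a as n m k ⟩
    node k ⊗ (Δ m (samples as n) (suc k) ⊖ Δ m (samples as n) k) ⊕ (ι (suc m) ⊗ h) ⊗ Δ m (samples as n) (suc k)
      ≡⟨ cong₂ (λ y x → node k ⊗ (y ⊖ x) ⊕ (ι (suc m) ⊗ h) ⊗ y) (Δ-vanishes as n (suc k)) (Δ-vanishes as n k) ⟩
    node k ⊗ 0ℚ ⊕ (ι (suc m) ⊗ h) ⊗ 0ℚ ≡⟨ cong₂ _⊕_ (ℚ.*-zeroʳ (node k)) (ℚ.*-zeroʳ (ι (suc m) ⊗ h)) ⟩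
    0ℚ ∎

  Δ-leading : ∀ {m} (as : Vec ℝ (suc m)) n k →
    Δ m (samples as n) k ≡ scaledFactorial h m ⊗ seq (last as) n
  Δ-leading (a ∷ []) n k = solve 2 (λ a x → a :+ x :* con 0ℚ := con 1ℚ :* a) refl (seq a n) (node k)
  Δ-leading {suc m} (a ∷ as@(b ∷ bs)) n k = begin-equality
    Δ (suc m) (samples (a ∷ as) n) k
      ≡⟨ Δ-samples-∷ a as n m k ⟩
    node k ⊗ Δ (suc m) (samples as n) k ⊕ (ι (suc m) ⊗ h) ⊗ Δ m (samples as n) (suc k)
      ≡⟨ cong₂ (λ x y → node k ⊗ x ⊕ (ι (suc m) ⊗ h) ⊗ y) (Δ-vanishes as n k) (Δ-leading as n (suc k)) ⟩
    node k ⊗ 0ℚ ⊕ (ι (suc m) ⊗ h) ⊗ (scaledFactorial h m ⊗ seq (last as) n)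
      ≡⟨ solve 4 (λ x i f l → x :* con 0ℚ :+ i :* (f :* l) := (i :* f) :* l) refl
           (node k) (ι (suc m) ⊗ h) (scaledFactorial h m) (seq (last as) n) ⟩
    scaledFactorial h (suc m) ⊗ seq (last as) n ∎

-- The functional equation of the exponential function

*-cancel-≡ : ∀ K {a b} → 0ℚ ≺ K → K ⊗ a ≡ K ⊗ b → a ≡ b
*-cancel-≡ K {a} {b} 0<K eq = ℚ.≤-antisym
  (*-cancel-≤ {K} {a} {b} 0<K (ℚ.≤-reflexive eq)) (*-cancel-≤ {K} {b} {a} 0<K (ℚ.≤-reflexive (sym eq)))

-- Unlike `expSum`, this splits off the lowest term, in step with the recursion of `conv`.
sumTo : (ℕ → ℚ) → ℕ → ℚ
sumTo f zero    = f 0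
sumTo f (suc n) = f 0 ⊕ sumTo (f ∘ suc) n

sumTo-suc : ∀ f n → sumTo f (suc n) ≡ sumTo f n ⊕ f (suc n)
sumTo-suc f zero    = refl
sumTo-suc f (suc n) = trans (cong (f 0 ⊕_) (sumTo-suc (f ∘ suc) n))
  (sym (ℚ.+-assoc (f 0) (sumTo (f ∘ suc) n) (f (suc (suc n)))))

expSum≡sumTo : ∀ q n → expSum q n ≡ sumTo (term q) n
expSum≡sumTo q zero    = refl
expSum≡sumTo q (suc n) = trans (cong (_⊕ term q (suc n)) (expSum≡sumTo q n)) (sym (sumTo-suc (term q) n))

-- The `n`-th coefficient of the Cauchy product of `f` and `g`.
conv : (ℕ → ℚ) → (ℕ → ℚ) → ℕ → ℚ
conv f g zero    = f 0 ⊗ g 0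
conv f g (suc n) = f 0 ⊗ g (suc n) ⊕ conv (f ∘ suc) g n

conv-scaleˡ : ∀ {f f′} a g → (∀ i → f′ i ≡ f i ⊗ a) → ∀ n → conv f′ g n ≡ conv f g n ⊗ a
conv-scaleˡ {f} {f′} a g eq zero = trans (cong (_⊗ g 0) (eq 0))
  (solve 3 (λ f a g → (f :* a) :* g := (f :* g) :* a) refl (f 0) a (g 0))
conv-scaleˡ {f} {f′} a g eq (suc n) = trans
  (cong₂ (λ x y → x ⊗ g (suc n) ⊕ y) (eq 0) (conv-scaleˡ a g (eq ∘ suc) n))
  (solve 4 (λ f a g c → (f :* a) :* g :+ c :* a := (f :* g :+ c) :* a) refl
    (f 0) a (g (suc n)) (conv (f ∘ suc) g n))

conv-shiftʳ : ∀ f {g g′} b → g′ 0 ≡ 0ℚ → (∀ j → g′ (suc j) ≡ g j ⊗ b) →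
  ∀ n → conv f g′ (suc n) ≡ conv f g n ⊗ b
conv-shiftʳ f {g} b eq₀ eq zero = trans
  (cong₂ (λ x y → f 0 ⊗ x ⊕ f 1 ⊗ y) (eq 0) eq₀)
  (solve 4 (λ f f₁ g b → f :* (g :* b) :+ f₁ :* con 0ℚ := (f :* g) :* b) refl (f 0) (f 1) (g 0) b)
conv-shiftʳ f {g} b eq₀ eq (suc n) = trans
  (cong₂ (λ x y → f 0 ⊗ x ⊕ y) (eq (suc n)) (conv-shiftʳ (f ∘ suc) b eq₀ eq n))
  (solve 4 (λ f g b c → f :* (g :* b) :+ c :* b := (f :* g :+ c) :* b) refl
    (f 0) (g (suc n)) b (conv (f ∘ suc) g n))

-- Every summand f i · g (n - i) satisfies w 0 + n = w i + (n - i): this is the product rule for x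
-- d/dx read off on coefficients. A general `w` is needed because the recursion shifts `f`, so that
-- the weights no longer start at 0.
conv-weight : ∀ (w : ℕ → ℚ) → (∀ i → w (suc i) ≡ w i ⊕ 1ℚ) → ∀ f g n →
  (w 0 ⊕ ι n) ⊗ conv f g n ≡ conv (λ i → w i ⊗ f i) g n ⊕ conv f (λ j → ι j ⊗ g j) n
conv-weight w step f g zero = solve 3 (λ w f g →
  (w :+ con 0ℚ) :* (f :* g) := (w :* f) :* g :+ f :* (con 0ℚ :* g)) refl (w 0) (f 0) (g 0)
conv-weight w step f g (suc n) = begin-equality
  (w 0 ⊕ ι (suc n)) ⊗ (f 0 ⊗ g (suc n) ⊕ c)
    ≡⟨ solve 4 (λ w i p c → (w :+ i) :* (p :+ c) := (w :+ i) :* p :+ (w :+ i) :* c) refl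
         (w 0) (ι (suc n)) (f 0 ⊗ g (suc n)) c ⟩
  (w 0 ⊕ ι (suc n)) ⊗ (f 0 ⊗ g (suc n)) ⊕ (w 0 ⊕ ι (suc n)) ⊗ c
    ≡⟨ cong (λ v → (w 0 ⊕ ι (suc n)) ⊗ (f 0 ⊗ g (suc n)) ⊕ v ⊗ c) shift ⟩
  (w 0 ⊕ ι (suc n)) ⊗ (f 0 ⊗ g (suc n)) ⊕ (w 1 ⊕ ι n) ⊗ c
    ≡⟨ cong ((w 0 ⊕ ι (suc n)) ⊗ (f 0 ⊗ g (suc n)) ⊕_)
         (conv-weight (w ∘ suc) (step ∘ suc) (f ∘ suc) g n) ⟩
  (w 0 ⊕ ι (suc n)) ⊗ (f 0 ⊗ g (suc n)) ⊕ (x ⊕ y)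
    ≡⟨ solve 6 (λ w i f g x y → (w :+ i) :* (f :* g) :+ (x :+ y) :=
         ((w :* f) :* g :+ x) :+ (f :* (i :* g) :+ y)) refl (w 0) (ι (suc n)) (f 0) (g (suc n)) x y ⟩
  ((w 0 ⊗ f 0) ⊗ g (suc n) ⊕ x) ⊕ (f 0 ⊗ (ι (suc n) ⊗ g (suc n)) ⊕ y) ∎
  where
  c = conv (f ∘ suc) g n
  x = conv (λ i → w (suc i) ⊗ f (suc i)) g n
  y = conv (f ∘ suc) (λ j → ι j ⊗ g j) n
  shift : w 0 ⊕ ι (suc n) ≡ w 1 ⊕ ι n
  shift = trans (cong (w 0 ⊕_) (ι-suc n)) (trans
    (solve 2 (λ w i → w :+ (i :+ con 1ℚ) := (w :+ con 1ℚ) :+ i) refl (w 0) (ι n))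
    (cong (_⊕ ι n) (sym (step 0))))

-- The binomial theorem, from (n+1) c_{n+1} = (a + b) c_n for both sides.
conv-term : ∀ a b n → conv (term a) (term b) n ≡ term (a ⊕ b) n
conv-term a b zero    = refl
conv-term a b (suc n) = *-cancel-≡ (ι (suc n)) 0<ι (begin-equality
  ι (suc n) ⊗ conv (term a) (term b) (suc n)
    ≡⟨ cong (_⊗ conv (term a) (term b) (suc n)) (ℚ.+-identityˡ (ι (suc n))) ⟨
  (0ℚ ⊕ ι (suc n)) ⊗ conv (term a) (term b) (suc n)
    ≡⟨ conv-weight ι ι-suc (term a) (term b) (suc n) ⟩
  ((0ℚ ⊗ term a 0) ⊗ term b (suc n) ⊕ conv (λ i → ι (suc i) ⊗ term a (suc i)) (term b) n)
    ⊕ conv (term a) (λ j → ι j ⊗ term b j) (suc n)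
    ≡⟨ cong₂ (λ x y → ((0ℚ ⊗ term a 0) ⊗ term b (suc n) ⊕ x) ⊕ y)
         (conv-scaleˡ a (term b) (term-suc a) n)
         (conv-shiftʳ (term a) {term b} {λ j → ι j ⊗ term b j} b (ℚ.*-zeroˡ (term b 0)) (term-suc b) n) ⟩
  ((0ℚ ⊗ term a 0) ⊗ term b (suc n) ⊕ c ⊗ a) ⊕ c ⊗ b
    ≡⟨ solve 5 (λ s t c a b → ((con 0ℚ :* s) :* t :+ c :* a) :+ c :* b := c :* (a :+ b)) refl
         (term a 0) (term b (suc n)) c a b ⟩
  c ⊗ (a ⊕ b)
    ≡⟨ cong (_⊗ (a ⊕ b)) (conv-term a b n) ⟩
  term (a ⊕ b) n ⊗ (a ⊕ b)
    ≡⟨ term-suc (a ⊕ b) n ⟨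
  ι (suc n) ⊗ term (a ⊕ b) (suc n) ∎)
  where
  c = conv (term a) (term b) n
  0<ι : 0ℚ ≺ ι (suc n)
  0<ι = ℚ.<-≤-trans 0<1 (ι-mono {1} {suc n} (s≤s z≤n))

conv-partialSums : ∀ f {g G} → G 0 ≡ g 0 → (∀ j → G (suc j) ≡ G j ⊕ g (suc j)) →
  ∀ n → conv f G (suc n) ≡ conv f G n ⊕ conv f g (suc n)
conv-partialSums f {g} {G} eq₀ eq zero = trans
  (cong₂ (λ x y → f 0 ⊗ x ⊕ f 1 ⊗ y) (eq 0) eq₀)
  (solve 5 (λ f f₁ G g g₁ → f :* (G :+ g₁) :+ f₁ :* g := f :* G :+ (f :* g₁ :+ f₁ :* g)) refl
    (f 0) (f 1) (G 0) (g 0) (g 1))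
conv-partialSums f {g} {G} eq₀ eq (suc n) = trans
  (cong₂ (λ x y → f 0 ⊗ x ⊕ y) (eq (suc n)) (conv-partialSums (f ∘ suc) eq₀ eq n))
  (solve 5 (λ f G g c d → f :* (G :+ g) :+ (c :+ d) := (f :* G :+ c) :+ (f :* g :+ d)) refl
    (f 0) (G (suc n)) (g (suc (suc n))) (conv (f ∘ suc) G n) (conv (f ∘ suc) g (suc n)))

-- Convolving with partial sums adds up all products of terms with i + j ≤ n. By the binomial
-- theorem this triangular sum is exact, so the functional equation fails only by the part of the
-- square outside the triangle.
conv-expSum : ∀ a b n → conv (term a) (expSum b) n ≡ expSum (a ⊕ b) n
conv-expSum a b zero    = conv-term a b 0
conv-expSum a b (suc n) = trans
  (conv-partialSums (term a) {term b} {expSum b} refl (λ _ → refl) n)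
  (cong₂ _⊕_ (conv-expSum a b n) (conv-term a b (suc n)))

-- The product of two partial sums over a square exceeds the triangular sum by a
-- sum of products of terms, which absolute values can only increase.
square-triangle : ∀ {f f′ G G′} → (∀ i → ∥ f i ∥ ≼ f′ i) →
  (∀ n j → ∥ G (j ℕ.+ n) ⊖ G n ∥ ≼ G′ (j ℕ.+ n) ⊖ G′ n) → ∀ n j →
  ∥ sumTo f n ⊗ G (j ℕ.+ n) ⊖ conv f G n ∥ ≼ sumTo f′ n ⊗ G′ (j ℕ.+ n) ⊖ conv f′ G′ n
square-triangle {f} {f′} {G} {G′} f≤ G≤ zero j = subst₂ _≼_
  (cong ∥_∥ (expand (f 0) (G (j ℕ.+ 0)) (G 0))) (expand (f′ 0) (G′ (j ℕ.+ 0)) (G′ 0))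
  (∣*∣-mono {f 0} (f≤ 0) (G≤ 0 j))
  where
  expand : ∀ x y z → x ⊗ (y ⊖ z) ≡ x ⊗ y ⊖ x ⊗ z
  expand = solve 3 (λ x y z → x :* (y :- z) := x :* y :- x :* z) refl
square-triangle {f} {f′} {G} {G′} f≤ G≤ (suc n) j = subst₂ _≼_
  (cong ∥_∥ (regroup f G)) (regroup f′ G′)
  (∣+∣-mono {f 0 ⊗ (G (j ℕ.+ suc n) ⊖ G (suc n))}
    (∣*∣-mono {f 0} (f≤ 0) (G≤ (suc n) j))
    (square-triangle {f ∘ suc} {f′ ∘ suc} {G} {G′} (f≤ ∘ suc) G≤ n (suc j)))
  where
  regroup : ∀ f G → f 0 ⊗ (G (j ℕ.+ suc n) ⊖ G (suc n)) ⊕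
    (sumTo (f ∘ suc) n ⊗ G (suc j ℕ.+ n) ⊖ conv (f ∘ suc) G n) ≡
    sumTo f (suc n) ⊗ G (j ℕ.+ suc n) ⊖ conv f G (suc n)
  regroup f G rewrite sym (ℕ.+-suc j n) =
    solve 5 (λ f y z s c → f :* (y :- z) :+ (s :* y :- c) := (f :+ s) :* y :- (f :* z :+ c)) refl
      (f 0) (G (j ℕ.+ suc n)) (G (suc n)) (sumTo (f ∘ suc) n) (conv (f ∘ suc) G n)

expSum-nonNeg : ∀ {q} → 0ℚ ≼ q → ∀ n → 0ℚ ≼ expSum q n
expSum-nonNeg 0≤q zero    = term-nonNeg 0≤q 0
expSum-nonNeg 0≤q (suc n) = ℚ.+-mono-≤ (expSum-nonNeg 0≤q n) (term-nonNeg 0≤q (suc n))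

conv-nonNeg : ∀ {f g} → (∀ i → 0ℚ ≼ f i) → (∀ j → 0ℚ ≼ g j) → ∀ n → 0ℚ ≼ conv f g n
conv-nonNeg 0≤f 0≤g zero    = *-nonNeg (0≤f 0) (0≤g 0)
conv-nonNeg 0≤f 0≤g (suc n) =
  ℚ.+-mono-≤ (*-nonNeg (0≤f 0) (0≤g (suc n))) (conv-nonNeg (0≤f ∘ suc) 0≤g n)

-- The rectangle i ≤ m, j ≤ n lies inside the triangle i + j ≤ m + n, and all terms are nonnegative.
square≤triangle : ∀ {f b} → (∀ i → 0ℚ ≼ f i) → 0ℚ ≼ b → ∀ m n →
  sumTo f m ⊗ expSum b n ≼ conv f (expSum b) (m ℕ.+ n)
square≤triangle         0≤f 0≤b zero    zero    = ℚ.≤-refl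
square≤triangle {f} {b} 0≤f 0≤b zero    (suc n) = begin
  f 0 ⊗ expSum b (suc n)                                  ≡⟨ ℚ.+-identityʳ _ ⟨
  f 0 ⊗ expSum b (suc n) ⊕ 0ℚ                             ≤⟨ ℚ.+-monoʳ-≤ (f 0 ⊗ expSum b (suc n))
                                                             (conv-nonNeg (0≤f ∘ suc) (expSum-nonNeg 0≤b) n) ⟩
  f 0 ⊗ expSum b (suc n) ⊕ conv (f ∘ suc) (expSum b) n    ∎
square≤triangle {f} {b} 0≤f 0≤b (suc m) n       = begin
  (f 0 ⊕ sumTo (f ∘ suc) m) ⊗ expSum b n
    ≡⟨ ℚ.*-distribʳ-+ (expSum b n) (f 0) (sumTo (f ∘ suc) m) ⟩
  f 0 ⊗ expSum b n ⊕ sumTo (f ∘ suc) m ⊗ expSum b n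
    ≤⟨ ℚ.+-mono-≤ (ℚ.*-monoˡ-≤-nonNeg (f 0) {{ℚ.nonNegative (0≤f 0)}} (expSum-mono 0≤b n (suc m)))
                  (square≤triangle (0≤f ∘ suc) 0≤b m n) ⟩
  f 0 ⊗ expSum b (suc m ℕ.+ n) ⊕ conv (f ∘ suc) (expSum b) (m ℕ.+ n) ∎

-- Square minus triangle grows when `a` and `b` are replaced by their absolute values, and the
-- square fits into the triangle of size 2n. The defect thus becomes a stretch of a single series,
-- which its Cauchy property makes small.
expSum-product : ∀ a b n →
  ∥ expSum a n ⊗ expSum b n ⊖ expSum (a ⊕ b) n ∥ ≼
  ∥ expSum (∥ a ∥ ⊕ ∥ b ∥) (n ℕ.+ n) ⊖ expSum (∥ a ∥ ⊕ ∥ b ∥) n ∥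
expSum-product a b n = begin
  ∥ expSum a n ⊗ expSum b n ⊖ expSum (a ⊕ b) n ∥
    ≡⟨ cong₂ (λ s t → ∥ s ⊗ expSum b n ⊖ t ∥) (expSum≡sumTo a n) (sym (conv-expSum a b n)) ⟩
  ∥ sumTo (term a) n ⊗ expSum b n ⊖ conv (term a) (expSum b) n ∥
    ≤⟨ square-triangle {term a} {term A} {expSum b} {expSum B} (∥term∥≤ ℚ.≤-refl) (expSum-diff ℚ.≤-refl) n 0 ⟩
  sumTo (term A) n ⊗ expSum B n ⊖ conv (term A) (expSum B) n
    ≤⟨ ℚ.+-monoˡ-≤ (ℚ.- conv (term A) (expSum B) n)
         (square≤triangle (term-nonNeg (ℚ.0≤∣p∣ a)) (ℚ.0≤∣p∣ b) n n) ⟩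
  conv (term A) (expSum B) (n ℕ.+ n) ⊖ conv (term A) (expSum B) n
    ≡⟨ cong₂ _⊖_ (conv-expSum A B (n ℕ.+ n)) (conv-expSum A B n) ⟩
  expSum (A ⊕ B) (n ℕ.+ n) ⊖ expSum (A ⊕ B) n
    ≤⟨ p≤∣p∣ _ ⟩
  ∥ expSum (A ⊕ B) (n ℕ.+ n) ⊖ expSum (A ⊕ B) n ∥ ∎
  where
  A = ∥ a ∥
  B = ∥ b ∥

-- The rational estimate

^-mono-≤ : ∀ {a b} → 0ℚ ≼ a → a ≼ b → ∀ k → a ^ k ≼ b ^ k
^-mono-≤ 0≤a a≤b zero        = ℚ.≤-refl
^-mono-≤ {a} {b} 0≤a a≤b (suc k) =
  *-mono-≤ {a} {b} {a ^ k} {b ^ k} (ℚ.≤-trans 0≤a a≤b) (^-nonNeg 0≤a k) a≤b (^-mono-≤ 0≤a a≤b k)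

1^ : ∀ k → 1ℚ ^ k ≡ 1ℚ
1^ zero    = refl
1^ (suc k) = trans (ℚ.*-identityˡ (1ℚ ^ k)) (1^ k)

^-anti-≤ : ∀ {x} → 0ℚ ≼ x → x ≼ 1ℚ → ∀ {k m} → k ℕ.≤ m → x ^ m ≼ x ^ k
^-anti-≤ {x} 0≤x x≤1 {m = m} z≤n = subst (x ^ m ≼_) (1^ m) (^-mono-≤ 0≤x x≤1 m)
^-anti-≤ {x} 0≤x x≤1 (s≤s k≤m)   = ℚ.*-monoˡ-≤-nonNeg x {{ℚ.nonNegative 0≤x}} (^-anti-≤ 0≤x x≤1 k≤m)

-- With W = 1/w and P = 1/r, the difference P - W equals P W (w - r). The condition 2e ≤ w forces
-- 2|r| ≥ w, hence |P| ≤ 2W.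
reciprocal-close : ∀ {w W P r e} → 0ℚ ≼ W → w ⊗ W ≡ 1ℚ → P ⊗ r ≡ 1ℚ →
  ∥ w ⊖ r ∥ ≼ e → e ⊕ e ≼ w → ∥ P ⊖ W ∥ ≼ (e ⊕ e) ⊗ (W ⊗ W)
reciprocal-close {w} {W} {P} {r} {e} 0≤W wW≡1 Pr≡1 close 2e≤w = begin
  ∥ P ⊖ W ∥                          ≡⟨ cong₂ (λ x y → ∥ x ⊖ y ∥) P≡ W≡ ⟩
  ∥ P ⊗ (w ⊗ W) ⊖ W ⊗ (P ⊗ r) ∥      ≡⟨ cong ∥_∥ (solve 4 (λ w W P r →
                                        P :* (w :* W) :- W :* (P :* r) := (P :* W) :* (w :- r))
                                        refl w W P r) ⟩
  ∥ (P ⊗ W) ⊗ (w ⊖ r) ∥              ≤⟨ ∣*∣-mono {P ⊗ W} (∣*∣-mono {P} P≤2W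
                                        (ℚ.≤-reflexive (ℚ.0≤p⇒∣p∣≡p 0≤W))) close ⟩
  ((W ⊕ W) ⊗ W) ⊗ e                  ≡⟨ solve 2 (λ W e → ((W :+ W) :* W) :* e := (e :+ e) :* (W :* W)) refl W e ⟩
  (e ⊕ e) ⊗ (W ⊗ W)                  ∎
  where
  P≡ : P ≡ P ⊗ (w ⊗ W)
  P≡ = sym (trans (cong (P ⊗_) wW≡1) (ℚ.*-identityʳ P))
  W≡ : W ≡ W ⊗ (P ⊗ r)
  W≡ = sym (trans (cong (W ⊗_) Pr≡1) (ℚ.*-identityʳ W))
  w≤r+e : w ≼ ∥ r ∥ ⊕ e
  w≤r+e = ℚ.≤-trans (p≤∣p∣ w) (ℚ.≤-trans (∣∣-shift w r) (ℚ.+-monoʳ-≤ ∥ r ∥ close))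
  w≤2r : w ≼ ∥ r ∥ ⊕ ∥ r ∥
  w≤2r = begin
    w                                ≡⟨ solve 1 (λ w → w := (w :+ w) :- w) refl w ⟩
    (w ⊕ w) ⊖ w                      ≤⟨ ℚ.+-mono-≤ (ℚ.+-mono-≤ w≤r+e w≤r+e) (ℚ.neg-antimono-≤ 2e≤w) ⟩
    ((∥ r ∥ ⊕ e) ⊕ (∥ r ∥ ⊕ e)) ⊖ (e ⊕ e)  ≡⟨ solve 2 (λ r e → ((r :+ e) :+ (r :+ e)) :- (e :+ e) := r :+ r)
                                        refl ∥ r ∥ e ⟩
    ∥ r ∥ ⊕ ∥ r ∥                    ∎
  P≤2W : ∥ P ∥ ≼ W ⊕ W
  P≤2W = begin
    ∥ P ∥                            ≡⟨ trans (cong (∥ P ∥ ⊗_) wW≡1) (ℚ.*-identityʳ ∥ P ∥) ⟨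
    ∥ P ∥ ⊗ (w ⊗ W)                  ≤⟨ ℚ.*-monoˡ-≤-nonNeg ∥ P ∥ {{ℚ.∣-∣-nonNeg P}}
                                        (ℚ.*-monoʳ-≤-nonNeg W {{ℚ.nonNegative 0≤W}} w≤2r) ⟩
    ∥ P ∥ ⊗ ((∥ r ∥ ⊕ ∥ r ∥) ⊗ W)    ≡⟨ solve 3 (λ p r W → p :* ((r :+ r) :* W) := (p :* r) :* (W :+ W))
                                        refl ∥ P ∥ ∥ r ∥ W ⟩
    (∥ P ∥ ⊗ ∥ r ∥) ⊗ (W ⊕ W)        ≡⟨ cong (_⊗ (W ⊕ W)) (trans (sym (ℚ.∣p*q∣≡∣p∣*∣q∣ P r)) (cong ∥_∥ Pr≡1)) ⟩
    1ℚ ⊗ (W ⊕ W)                     ≡⟨ ℚ.*-identityˡ (W ⊕ W) ⟩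
    W ⊕ W                            ∎

⅓ : ℚ
⅓ = + 1 / 3

module _ {d} (as : Vec ℝ (suc d)) (n : ℕ) {c e : ℚ} (r : ℕ → ℚ)
  (⅓≤c : ⅓ ≼ c) (c≤½ : c ≼ ½) (2e≤ : e ⊕ e ≼ ⅓ ^ suc d)
  (recip-P : ∀ {k} → k ℕ.≤ suc d → samples 0ℚ 1ℚ as n k ⊗ r k ≡ 1ℚ)
  (close : ∀ {k} → k ℕ.≤ suc d → ∥ c ^ k ⊖ r k ∥ ≼ e)
  where

  private
    0≤c : 0ℚ ≼ c
    0≤c = ℚ.≤-trans (from-yes (0ℚ ℚ.≤? ⅓)) ⅓≤c

    0<c : 0ℚ ≺ c
    0<c = ℚ.<-≤-trans (from-yes (0ℚ ℚ.<? ⅓)) ⅓≤c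

    t : ℚ
    t = proj₁ (scale {c} {1ℚ} 0<c 0<1)

    0≤t : 0ℚ ≼ t
    0≤t = ℚ.<⇒≤ (proj₁ (proj₂ (scale {c} {1ℚ} 0<c 0<1)))

    ct≡1 : c ⊗ t ≡ 1ℚ
    ct≡1 = proj₂ (proj₂ (scale {c} {1ℚ} 0<c 0<1))

    t≤3 : t ≼ ι 3
    t≤3 = *-cancel-≤ {⅓} {t} {ι 3} (from-yes (0ℚ ℚ.<? ⅓)) (begin
      ⅓ ⊗ t    ≤⟨ ℚ.*-monoʳ-≤-nonNeg t {{ℚ.nonNegative 0≤t}} ⅓≤c ⟩
      c ⊗ t    ≡⟨ ct≡1 ⟩
      ⅓ ⊗ ι 3  ∎)

    2≤t : ι 2 ≼ t
    2≤t = *-cancel-≤ {½} {ι 2} {t} 0<½ (begin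
      ½ ⊗ ι 2  ≡⟨ ct≡1 ⟨
      c ⊗ t    ≤⟨ ℚ.*-monoʳ-≤-nonNeg t {{ℚ.nonNegative 0≤t}} c≤½ ⟩
      ½ ⊗ t    ∎)

    2e≤c^ : ∀ {k} → k ℕ.≤ suc d → e ⊕ e ≼ c ^ k
    2e≤c^ {k} k≤ = ℚ.≤-trans 2e≤ (ℚ.≤-trans
      (^-anti-≤ (from-yes (0ℚ ℚ.≤? ⅓)) (from-yes (⅓ ℚ.≤? 1ℚ)) k≤)
      (^-mono-≤ (from-yes (0ℚ ℚ.≤? ⅓)) ⅓≤c k))

    deviation : ℕ → ℚ
    deviation k = samples 0ℚ 1ℚ as n k ⊖ t ^ k

    0≤2e : 0ℚ ≼ e ⊕ e
    0≤2e = ℚ.+-mono-≤ 0≤e 0≤e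
      where
      0≤e : 0ℚ ≼ e
      0≤e = ℚ.≤-trans (ℚ.0≤∣p∣ (c ^ 0 ⊖ r 0)) (close z≤n)

    deviation≤ : ∀ {k} → k ℕ.≤ suc d → ∥ deviation k ∥ ≼ (e ⊕ e) ⊗ ι 9 ^ k
    deviation≤ {k} k≤ = begin
      ∥ deviation k ∥              ≤⟨ reciprocal-close {c ^ k} {t ^ k} {samples 0ℚ 1ℚ as n k} {r k} {e}
                                      (^-nonNeg 0≤t k)
                                      (trans (sym (^-distrib-* c t k)) (trans (cong (_^ k) ct≡1) (1^ k)))
                                      (recip-P k≤) (close k≤) (2e≤c^ k≤) ⟩
      (e ⊕ e) ⊗ (t ^ k ⊗ t ^ k)    ≡⟨ cong ((e ⊕ e) ⊗_) (^-distrib-* t t k) ⟨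
      (e ⊕ e) ⊗ (t ⊗ t) ^ k        ≤⟨ ℚ.*-monoˡ-≤-nonNeg (e ⊕ e) {{ℚ.nonNegative 0≤2e}}
                                      (^-mono-≤ (*-nonNeg 0≤t 0≤t)
                                        (*-mono-≤ {t} {ι 3} {t} {ι 3} (0≤ι 3) 0≤t t≤3 t≤3) k) ⟩
      (e ⊕ e) ⊗ ι 9 ^ k            ∎

    Δ-deviation : Δ (suc d) deviation 0 ⊕ (t ⊖ 1ℚ) ^ suc d ≡ 0ℚ
    Δ-deviation = begin-equality
      Δ (suc d) deviation 0 ⊕ (t ⊖ 1ℚ) ^ suc d
        ≡⟨ cong (Δ (suc d) deviation 0 ⊕_) (trans (Δ-geometric t (suc d) 0) (ℚ.*-identityʳ _)) ⟨
      Δ (suc d) deviation 0 ⊕ Δ (suc d) (t ^_) 0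
        ≡⟨ Δ-+ deviation (t ^_) (suc d) 0 ⟨
      Δ (suc d) (λ k → deviation k ⊕ t ^ k) 0
        ≡⟨ Δ-cong (λ k → solve 2 (λ p s → (p :- s) :+ s := p) refl (samples 0ℚ 1ℚ as n k) (t ^ k)) (suc d) 0 ⟩
      Δ (suc d) (samples 0ℚ 1ℚ as n) 0
        ≡⟨ Δ-vanishes 0ℚ 1ℚ as n 0 ⟩
      0ℚ ∎

  -- The bound c ≤ ½ gives t - 1 ≥ 1, so the difference of the powers of `t` cannot be small; only
  -- the deviation is left to cancel it.
  1≤2e*10^ : 1ℚ ≼ (e ⊕ e) ⊗ ι 10 ^ suc d
  1≤2e*10^ = begin
    1ℚ                               ≡⟨ 1^ (suc d) ⟨
    1ℚ ^ suc d                       ≤⟨ ^-mono-≤ 0≤1 (ℚ.+-monoˡ-≤ (ℚ.- 1ℚ) 2≤t) (suc d) ⟩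
    g                                ≡⟨ solve 2 (λ D g → g := (D :+ g) :- D) refl D g ⟩
    (D ⊕ g) ⊖ D                      ≡⟨ cong (_⊖ D) Δ-deviation ⟩
    0ℚ ⊖ D                           ≡⟨ ℚ.+-identityˡ (ℚ.- D) ⟩
    ℚ.- D                            ≤⟨ p≤∣p∣ (ℚ.- D) ⟩
    ∥ ℚ.- D ∥                        ≡⟨ ℚ.∣-p∣≡∣p∣ D ⟩
    ∥ D ∥                            ≤⟨ ∥Δ∥≤ (e ⊕ e) (ι 9) deviation deviation≤ (suc d)
                                          (ℕ.≤-reflexive (ℕ.+-identityʳ (suc d))) ⟩
    ((e ⊕ e) ⊗ ι 10 ^ suc d) ⊗ 1ℚ    ≡⟨ ℚ.*-identityʳ _ ⟩
    (e ⊕ e) ⊗ ι 10 ^ suc d           ∎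
    where
    D = Δ (suc d) deviation 0
    g = (t ⊖ 1ℚ) ^ suc d

-- Numerical inequalities for the threshold degree

1/50 : ℚ
1/50 = + 1 / 50

4*50⁻ᵈ≤3⁻ᵈ : ∀ {d} → 3 ℕ.≤ d → ι 4 ⊗ 1/50 ^ d ≼ ⅓ ^ suc d
4*50⁻ᵈ≤3⁻ᵈ {d} 3≤d = begin
  -- Here 1/50 evaluates to ⅓ · 3/50; the powers of 3/50 pay for the factor 4 and the extra ⅓.
  ι 4 ⊗ (⅓ ⊗ x) ^ d      ≡⟨ cong (ι 4 ⊗_) (^-distrib-* ⅓ x d) ⟩
  ι 4 ⊗ (⅓ ^ d ⊗ x ^ d)  ≡⟨ solve 3 (λ i a b → i :* (a :* b) := (i :* b) :* a) refl (ι 4) (⅓ ^ d) (x ^ d) ⟩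
  (ι 4 ⊗ x ^ d) ⊗ ⅓ ^ d  ≤⟨ ℚ.*-monoʳ-≤-nonNeg (⅓ ^ d) {{ℚ.nonNegative (^-nonNeg (from-yes (0ℚ ℚ.≤? ⅓)) d)}}
                            (ℚ.≤-trans
                              (ℚ.*-monoˡ-≤-nonNeg (ι 4) (^-anti-≤ (from-yes (0ℚ ℚ.≤? x)) (from-yes (x ℚ.≤? 1ℚ)) 3≤d))
                              (from-yes (ι 4 ⊗ x ^ 3 ℚ.≤? ⅓))) ⟩
  ⅓ ⊗ ⅓ ^ d              ∎
  where x = + 3 / 50

-- The left side is 40 · 5⁻ᵈ, which drops below 1 exactly from d = 3 on; this sets the threshold
-- degree.
4*50⁻ᵈ*10ᵈ<1 : ∀ {d} → 3 ℕ.≤ d → (ι 4 ⊗ 1/50 ^ d) ⊗ ι 10 ^ suc d ≺ 1ℚ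
4*50⁻ᵈ*10ᵈ<1 {d} 3≤d = begin-strict
  (ι 4 ⊗ 1/50 ^ d) ⊗ (ι 10 ⊗ ι 10 ^ d)  ≡⟨ solve 4 (λ i a j b → (i :* a) :* (j :* b) := (i :* j) :* (a :* b)) refl
                                           (ι 4) (1/50 ^ d) (ι 10) (ι 10 ^ d) ⟩
  ι 40 ⊗ (1/50 ^ d ⊗ ι 10 ^ d)          ≡⟨ cong (ι 40 ⊗_) (^-distrib-* 1/50 (ι 10) d) ⟨
  ι 40 ⊗ x ^ d                          ≤⟨ ℚ.*-monoˡ-≤-nonNeg (ι 40)
                                           (^-anti-≤ (from-yes (0ℚ ℚ.≤? x)) (from-yes (x ℚ.≤? 1ℚ)) 3≤d) ⟩
  ι 40 ⊗ x ^ 3                          <⟨ from-yes (ι 40 ⊗ x ^ 3 ℚ.<? 1ℚ) ⟩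
  1ℚ                                    ∎
  where x = + 1 / 5

-- Bounds on the partial sums for e⁻¹

module e⁻¹ where
  term-halves : ∀ k → term 1ℚ (suc (suc k)) ⊕ term 1ℚ (suc (suc k)) ≼ term 1ℚ (suc k)
  term-halves k = begin
    t′ ⊕ t′                        ≡⟨ solve 1 (λ t → t :+ t := con (ι 2) :* t) refl t′ ⟩
    ι 2 ⊗ t′                       ≤⟨ ℚ.*-monoʳ-≤-nonNeg t′ {{ℚ.nonNegative (term-nonNeg 0≤1 (suc (suc k)))}}
                                      (ι-mono {2} {suc (suc k)} (s≤s (s≤s z≤n))) ⟩
    ι (suc (suc k)) ⊗ t′           ≡⟨ term-suc 1ℚ (suc k) ⟩
    term 1ℚ (suc k) ⊗ 1ℚ           ≡⟨ ℚ.*-identityʳ _ ⟩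
    term 1ℚ (suc k)                ∎
    where t′ = term 1ℚ (suc (suc k))

  tail≤ : ∀ j → expSum 1ℚ (j ℕ.+ 4) ⊕ term 1ℚ (j ℕ.+ 4) ≼ expSum 1ℚ 4 ⊕ term 1ℚ 4
  tail≤ zero    = ℚ.≤-refl
  tail≤ (suc j) = begin
    (expSum 1ℚ (j ℕ.+ 4) ⊕ t′) ⊕ t′            ≡⟨ ℚ.+-assoc (expSum 1ℚ (j ℕ.+ 4)) t′ t′ ⟩
    expSum 1ℚ (j ℕ.+ 4) ⊕ (t′ ⊕ t′)            ≤⟨ ℚ.+-monoʳ-≤ (expSum 1ℚ (j ℕ.+ 4)) halves ⟩
    expSum 1ℚ (j ℕ.+ 4) ⊕ term 1ℚ (j ℕ.+ 4)    ≤⟨ tail≤ j ⟩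
    expSum 1ℚ 4 ⊕ term 1ℚ 4                    ∎
    where
    t′ = term 1ℚ (suc j ℕ.+ 4)
    halves : t′ ⊕ t′ ≼ term 1ℚ (j ℕ.+ 4)
    halves rewrite ℕ.+-comm j 4 = term-halves (3 ℕ.+ j)

  -- The tail is dominated by the series at 1, whose terms at least halve, so it is at most the last
  -- term kept, 1/24. Since the sum up to index 4 is 3/8, all later sums lie between 1/3 and 5/12;
  -- stopping at index 3 would give only 1/6 as lower bound.
  near : ∀ j → ∥ expSum (ℚ.- 1ℚ) (j ℕ.+ 4) ⊖ expSum (ℚ.- 1ℚ) 4 ∥ ≼ term 1ℚ 4
  near j = begin
    ∥ expSum (ℚ.- 1ℚ) (j ℕ.+ 4) ⊖ expSum (ℚ.- 1ℚ) 4 ∥  ≤⟨ expSum-diff {ℚ.- 1ℚ} {1ℚ} ℚ.≤-refl 4 j ⟩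
    S ⊖ expSum 1ℚ 4                                    ≡⟨ cong (_⊖ expSum 1ℚ 4) (ℚ.+-identityʳ S) ⟨
    (S ⊕ 0ℚ) ⊖ expSum 1ℚ 4                             ≤⟨ ℚ.+-monoˡ-≤ (ℚ.- expSum 1ℚ 4) (ℚ.≤-trans
                                                          (ℚ.+-monoʳ-≤ S (term-nonNeg 0≤1 (j ℕ.+ 4))) (tail≤ j)) ⟩
    (expSum 1ℚ 4 ⊕ term 1ℚ 4) ⊖ expSum 1ℚ 4            ≡⟨⟩
    term 1ℚ 4                                          ∎
    where S = expSum 1ℚ (j ℕ.+ 4)

  ≤½ : ∀ {n} → 4 ℕ.≤ n → expSum (ℚ.- 1ℚ) n ≼ ½
  ≤½ {n} 4≤n = subst (λ m → expSum (ℚ.- 1ℚ) m ≼ ½) (ℕ.m∸n+n≡m 4≤n) (begin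
    S                                          ≡⟨ solve 2 (λ S s → S := (S :- s) :+ s) refl S (expSum (ℚ.- 1ℚ) 4) ⟩
    (S ⊖ expSum (ℚ.- 1ℚ) 4) ⊕ expSum (ℚ.- 1ℚ) 4  ≤⟨ ℚ.+-monoˡ-≤ (expSum (ℚ.- 1ℚ) 4)
                                                     (ℚ.≤-trans (p≤∣p∣ _) (near (n ℕ.∸ 4))) ⟩
    term 1ℚ 4 ⊕ expSum (ℚ.- 1ℚ) 4              ≤⟨ from-yes (term 1ℚ 4 ⊕ expSum (ℚ.- 1ℚ) 4 ℚ.≤? ½) ⟩
    ½                                          ∎)
    where S = expSum (ℚ.- 1ℚ) (n ℕ.∸ 4 ℕ.+ 4)

  ≥⅓ : ∀ {n} → 4 ℕ.≤ n → ⅓ ≼ expSum (ℚ.- 1ℚ) n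
  ≥⅓ {n} 4≤n = subst (λ m → ⅓ ≼ expSum (ℚ.- 1ℚ) m) (ℕ.m∸n+n≡m 4≤n) (begin
    ⅓                                          ≡⟨⟩
    expSum (ℚ.- 1ℚ) 4 ⊖ term 1ℚ 4              ≤⟨ ℚ.+-monoʳ-≤ (expSum (ℚ.- 1ℚ) 4) (ℚ.neg-antimono-≤ (ℚ.≤-trans
                                                    (ℚ.≤-trans (p≤∣p∣ _) (ℚ.≤-reflexive (∣-∣-comm (expSum (ℚ.- 1ℚ) 4) S)))
                                                    (near (n ℕ.∸ 4)))) ⟩
    expSum (ℚ.- 1ℚ) 4 ⊖ (expSum (ℚ.- 1ℚ) 4 ⊖ S)  ≡⟨ solve 2 (λ S s → s :- (s :- S) := S) refl S (expSum (ℚ.- 1ℚ) 4) ⟩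
    S                                          ∎)
    where S = expSum (ℚ.- 1ℚ) (n ℕ.∸ 4 ℕ.+ 4)

-- Passage to real numbers

Eventually : (ℕ → Set) → Set
Eventually P = Σ ℕ λ N → ∀ {n} → N ℕ.≤ n → P n

infixr 2 _∩_
_∩_ : ∀ {P Q} → Eventually P → Eventually Q → Eventually (λ n → P n × Q n)
(M , p) ∩ (N , q) = M ℕ.⊔ N , λ n≥ → p (ℕ.m⊔n≤o⇒m≤o M N n≥) , q (ℕ.m⊔n≤o⇒n≤o M N n≥)

map : ∀ {P Q : ℕ → Set} → (∀ {n} → P n → Q n) → Eventually P → Eventually Q
map f (N , p) = N , λ n≥ → f (p n≥)

witness : ∀ {P} → Eventually P → Σ ℕ P
witness (N , p) = N , p ℕ.≤-refl

≤suc-split : ∀ (P : ℕ → Set) {K} → (∀ k → k ℕ.≤ K → P k) → P (suc K) → ∀ k → k ℕ.≤ suc K → P k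
≤suc-split P p q k k≤ with ℕ.m≤n⇒m<n∨m≡n k≤
... | inj₁ (s≤s k≤K) = p k k≤K
... | inj₂ refl      = q

eventually-∀≤ : ∀ (P : ℕ → ℕ → Set) K → (∀ k → k ℕ.≤ K → Eventually (P k)) →
  Eventually (λ n → ∀ k → k ℕ.≤ K → P k n)
eventually-∀≤ P zero    ev = map (λ { p _ z≤n → p }) (ev 0 z≤n)
eventually-∀≤ P (suc K) ev = map (λ {n} (p , q) → ≤suc-split (λ k → P k n) p q)
  (eventually-∀≤ P K (λ k → ev k ∘ ℕ.m≤n⇒m≤1+n) ∩ ev (suc K) ℕ.≤-refl)

-- Apartness from 0 is undecidable, so nonvanishing is known only under a double negation; for
-- finitely many points these merge into one, which a negative goal discharges.
¬¬-∀≤ : ∀ (P : ℕ → Set) K → (∀ k → k ℕ.≤ K → ¬ ¬ P k) → ¬ ¬ (∀ k → k ℕ.≤ K → P k)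
¬¬-∀≤ P zero    nn ¬all = nn 0 z≤n λ p → ¬all λ { _ z≤n → p }
¬¬-∀≤ P (suc K) nn ¬all = ¬¬-∀≤ P K (λ k → nn k ∘ ℕ.m≤n⇒m≤1+n) λ p →
  nn (suc K) ℕ.≤-refl λ q → ¬all (≤suc-split P p q)

half≤ : ∀ {ε} → 0ℚ ≺ ε → ε ⊗ ½ ≼ ε
half≤ {ε} 0<ε = subst (ε ⊗ ½ ≼_) (half+half ε) (subst (_≼ ε ⊗ ½ ⊕ ε ⊗ ½) (ℚ.+-identityʳ (ε ⊗ ½))
  (ℚ.+-monoʳ-≤ (ε ⊗ ½) (ℚ.<⇒≤ (0<half 0<ε))))

∣-∣≤⇒≤+ : ∀ a b {e} → ∥ a ⊖ b ∥ ≼ e → a ≼ b ⊕ e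
∣-∣≤⇒≤+ a b {e} close = begin
  a              ≡⟨ solve 2 (λ a b → a := b :+ (a :- b)) refl a b ⟩
  b ⊕ (a ⊖ b)    ≤⟨ ℚ.+-monoʳ-≤ b (ℚ.≤-trans (p≤∣p∣ (a ⊖ b)) close) ⟩
  b ⊕ e          ∎

-- Comparison of rationals is decidable: at an index where `y` has settled up to ε/4, either `a` is
-- at most that term plus ε/2, or the strict inequality holds with gap ε/4.
fromℚ≤-stable : ∀ {a} y → ¬ (y < fromℚ a) → fromℚ a ≤ y
fromℚ≤-stable {a} y y≮a = mk≤ λ {ε} 0<ε → below 0<ε (cauchy y (0<half (0<half 0<ε)))
  where
  below : ∀ {ε} → 0ℚ ≺ ε →
    (Σ ℕ λ N → ∀ {m n} → N ℕ.≤ m → N ℕ.≤ n → ∥ seq y m ⊖ seq y n ∥ ≼ (ε ⊗ ½) ⊗ ½) →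
    Eventually (λ n → a ≼ seq y n ⊕ ε)
  below {ε} 0<ε (N , close) with ℚ.≤-total a (seq y N ⊕ ε ⊗ ½)
  ... | inj₁ a≤ = N , λ {n} n≥ → begin
    a                                  ≤⟨ a≤ ⟩
    seq y N ⊕ h                        ≤⟨ ℚ.+-monoˡ-≤ h (∣-∣≤⇒≤+ (seq y N) (seq y n)
                                          (ℚ.≤-trans (close ℕ.≤-refl n≥) (half≤ (0<half 0<ε)))) ⟩
    (seq y n ⊕ h) ⊕ h                  ≡⟨ ℚ.+-assoc (seq y n) h h ⟩
    seq y n ⊕ (h ⊕ h)                  ≡⟨ cong (seq y n ⊕_) (half+half ε) ⟩
    seq y n ⊕ ε                        ∎
    where h = ε ⊗ ½
  ... | inj₂ ≤a = contradiction (mk< (h ⊗ ½) (0<half (0<half 0<ε)) N λ {n} n≥ → begin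
    seq y n ⊕ h ⊗ ½                    ≤⟨ ℚ.+-monoˡ-≤ (h ⊗ ½) (∣-∣≤⇒≤+ (seq y n) (seq y N) (close n≥ ℕ.≤-refl)) ⟩
    (seq y N ⊕ h ⊗ ½) ⊕ h ⊗ ½          ≡⟨ ℚ.+-assoc (seq y N) (h ⊗ ½) (h ⊗ ½) ⟩
    seq y N ⊕ (h ⊗ ½ ⊕ h ⊗ ½)          ≡⟨ cong (seq y N ⊕_) (half+half h) ⟩
    seq y N ⊕ h                        ≤⟨ ≤a ⟩
    a                                  ∎) y≮a
    where h = ε ⊗ ½

-- If one settled term exceeded ε/2 in absolute value, its sign would decide on which side of 0 the
-- limit lies, with gap ε/4.
¬#0⇒small : ∀ x → ¬ (x # 0ℝ) → ∀ {ε} → 0ℚ ≺ ε → Eventually (λ n → ∥ seq x n ∥ ≼ ε)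
¬#0⇒small x ¬x# {ε} 0<ε = small (cauchy x (0<half (0<half 0<ε)))
  where
  h = ε ⊗ ½
  g = h ⊗ ½
  small : (Σ ℕ λ N → ∀ {m n} → N ℕ.≤ m → N ℕ.≤ n → ∥ seq x m ⊖ seq x n ∥ ≼ g) →
    Eventually (λ n → ∥ seq x n ∥ ≼ ε)
  small (N , close) with ℚ.≤-total ∥ seq x N ∥ h
  ... | inj₁ x≤h = N , λ {n} n≥ → begin
    ∥ seq x n ∥                                ≤⟨ ∣∣-shift (seq x n) (seq x N) ⟩
    ∥ seq x N ∥ ⊕ ∥ seq x n ⊖ seq x N ∥        ≤⟨ ℚ.+-mono-≤ x≤h (ℚ.≤-trans (close n≥ ℕ.≤-refl) (half≤ (0<half 0<ε))) ⟩
    h ⊕ h                                      ≡⟨ half+half ε ⟩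
    ε                                          ∎
  ... | inj₂ h≤x with ℚ.∣p∣≡p∨∣p∣≡-p (seq x N)
  ... | inj₁ eq = contradiction (inj₂ (mk< g (0<half (0<half 0<ε)) N λ {n} n≥ → begin
    0ℚ ⊕ g                   ≡⟨ solve 1 (λ g → con 0ℚ :+ g := (g :+ g) :- g) refl g ⟩
    (g ⊕ g) ⊖ g              ≡⟨ cong (_⊖ g) (half+half h) ⟩
    h ⊖ g                    ≤⟨ ℚ.+-monoˡ-≤ (ℚ.- g) (subst (h ≼_) eq h≤x) ⟩
    seq x N ⊖ g              ≤⟨ ℚ.+-monoˡ-≤ (ℚ.- g) (∣-∣≤⇒≤+ (seq x N) (seq x n) (close ℕ.≤-refl n≥)) ⟩
    (seq x n ⊕ g) ⊖ g        ≡⟨ solve 2 (λ x g → (x :+ g) :- g := x) refl (seq x n) g ⟩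
    seq x n                  ∎)) ¬x#
  ... | inj₂ eq = contradiction (inj₁ (mk< g (0<half (0<half 0<ε)) N λ {n} n≥ → begin
    seq x n ⊕ g              ≤⟨ ℚ.+-monoˡ-≤ g (∣-∣≤⇒≤+ (seq x n) (seq x N) (close n≥ ℕ.≤-refl)) ⟩
    (seq x N ⊕ g) ⊕ g        ≡⟨ solve 2 (λ x g → (x :+ g) :+ g := (g :+ g) :- (:- x)) refl (seq x N) g ⟩
    (g ⊕ g) ⊖ (ℚ.- seq x N)  ≡⟨ cong₂ _⊖_ (half+half h) (sym eq) ⟩
    h ⊖ ∥ seq x N ∥          ≤⟨ ℚ.+-monoˡ-≤ (ℚ.- ∥ seq x N ∥) h≤x ⟩
    ∥ seq x N ∥ ⊖ ∥ seq x N ∥  ≡⟨ ℚ.+-inverseʳ ∥ seq x N ∥ ⟩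
    0ℚ                       ∎)) ¬x#

*-recip : ∀ {q} → q ≢ 0ℚ → q ⊗ recip q ≡ 1ℚ
*-recip {q} q≢0 with q ℚ.≟ 0ℚ
... | yes q≡0 = contradiction q≡0 q≢0
... | no q≢0′ = ℚ.*-inverseʳ q {{ℚ.≢-nonZero q≢0′}}

#0⇒*-recip : ∀ x → x # 0ℝ → Eventually (λ n → seq x n ⊗ recip (seq x n) ≡ 1ℚ)
#0⇒*-recip x x#0 with ∣∣-positive x x#0
... | δ , 0<δ , N , δ≤ = N , λ n≥ → *-recip λ x≡0 →
  ℚ.<-irrefl refl (ℚ.<-≤-trans 0<δ (subst (λ q → δ ≼ ∥ q ∥) x≡0 (δ≤ n≥)))

-- The gap of the strict inequality serves as the tolerance of the weak one, so the final bound
-- carries no slack.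
≤∧<⇒eventually≤ : ∀ {x y a} → x ≤ y → y < fromℚ a → Eventually (λ n → seq x n ≼ a)
≤∧<⇒eventually≤ (mk≤ below) (mk< g 0<g N y+g≤a) =
  map (λ (x≤ , y≤) → ℚ.≤-trans x≤ y≤) (below 0<g ∩ (N , λ {n} → y+g≤a {n}))

expSum-zero : ∀ n → expSum 0ℚ n ≡ 1ℚ
expSum-zero zero    = refl
expSum-zero (suc n) = trans
  (cong₂ _⊕_ (expSum-zero n) (trans (cong (_⊗ 1/! (suc n)) (ℚ.*-zeroˡ (0ℚ ^ n))) (ℚ.*-zeroˡ (1/! (suc n)))))
  (ℚ.+-identityʳ 1ℚ)

-- The functional equation up to a tolerance

abstract
  -- For a constant real the diagonal sequence defining `exp` is the plain sequence of partial sums.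
  expSum-cauchy : ∀ q → IsCauchy (expSum q)
  expSum-cauchy q = exp-cauchy (fromℚ q)

  expSum-bounded : ∀ q → Σ ℚ λ A → 0ℚ ≺ A × Eventually λ n → ∥ expSum q n ∥ ≼ A
  expSum-bounded q = bounded (exp (fromℚ q))

exp-+ : ∀ a b {ε} → 0ℚ ≺ ε →
  Eventually (λ n → ∥ expSum (a ⊕ b) n ⊖ expSum a n ⊗ expSum b n ∥ ≼ ε)
exp-+ a b {ε} 0<ε with expSum-cauchy (∥ a ∥ ⊕ ∥ b ∥) 0<ε
... | N , close = N , λ {n} n≥ → subst (_≼ ε)
  (∣-∣-comm (expSum a n ⊗ expSum b n) (expSum (a ⊕ b) n))
  (ℚ.≤-trans (expSum-product a b n) (close (ℕ.≤-trans n≥ (ℕ.m≤m+n n n)) n≥))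

-- Since the partial sum at -1 has absolute value at most 1 from index 4 on, multiplying by it does
-- not enlarge the earlier error; half the tolerance remains for the new product.
exp-power : ∀ k {ε} → 0ℚ ≺ ε →
  Eventually (λ n → ∥ expSum (ℚ.- 1ℚ) n ^ k ⊖ expSum (ℚ.- node 0ℚ 1ℚ k) n ∥ ≼ ε)
exp-power zero    {ε} 0<ε = 0 , λ {n} _ → subst (λ s → ∥ 1ℚ ⊖ s ∥ ≼ ε) (sym (expSum-zero n)) (ℚ.<⇒≤ 0<ε)
exp-power (suc k) {ε} 0<ε = map combine
  (exp-power k (0<half 0<ε) ∩ exp-+ x (ℚ.- 1ℚ) (0<half 0<ε) ∩ (4 , λ n≥ → n≥))
  where
  x = ℚ.- node 0ℚ 1ℚ k
  combine : ∀ {n} → ∥ expSum (ℚ.- 1ℚ) n ^ k ⊖ expSum x n ∥ ≼ ε ⊗ ½ ×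
    ∥ expSum (x ⊕ ℚ.- 1ℚ) n ⊖ expSum x n ⊗ expSum (ℚ.- 1ℚ) n ∥ ≼ ε ⊗ ½ × 4 ℕ.≤ n →
    ∥ expSum (ℚ.- 1ℚ) n ^ suc k ⊖ expSum (ℚ.- node 0ℚ 1ℚ (suc k)) n ∥ ≼ ε
  combine {n} (power , product , 4≤n) = begin
    ∥ c ⊗ c ^ k ⊖ expSum (ℚ.- node 0ℚ 1ℚ (suc k)) n ∥
      ≡⟨ cong (λ y → ∥ c ⊗ c ^ k ⊖ expSum y n ∥)
           (trans (cong ℚ.-_ (node-suc 0ℚ 1ℚ k)) (ℚ.neg-distrib-+ (node 0ℚ 1ℚ k) 1ℚ)) ⟩
    ∥ c ⊗ c ^ k ⊖ expSum (x ⊕ ℚ.- 1ℚ) n ∥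
      ≤⟨ triangle (c ⊗ c ^ k) (expSum x n ⊗ c) (expSum (x ⊕ ℚ.- 1ℚ) n) ⟩
    ∥ c ⊗ c ^ k ⊖ expSum x n ⊗ c ∥ ⊕ ∥ expSum x n ⊗ c ⊖ expSum (x ⊕ ℚ.- 1ℚ) n ∥
      ≡⟨ cong₂ _⊕_ (cong ∥_∥ (solve 3 (λ c p s → c :* p :- s :* c := (p :- s) :* c) refl c (c ^ k) (expSum x n)))
           (∣-∣-comm (expSum x n ⊗ c) (expSum (x ⊕ ℚ.- 1ℚ) n)) ⟩
    ∥ (c ^ k ⊖ expSum x n) ⊗ c ∥ ⊕ ∥ expSum (x ⊕ ℚ.- 1ℚ) n ⊖ expSum x n ⊗ c ∥
      ≤⟨ ℚ.+-mono-≤ (∣*∣-mono {c ^ k ⊖ expSum x n} power ∥c∥≤1) product ⟩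
    (ε ⊗ ½) ⊗ 1ℚ ⊕ ε ⊗ ½  ≡⟨ cong (_⊕ ε ⊗ ½) (ℚ.*-identityʳ (ε ⊗ ½)) ⟩
    ε ⊗ ½ ⊕ ε ⊗ ½         ≡⟨ half+half ε ⟩
    ε                     ∎
    where
    c = expSum (ℚ.- 1ℚ) n
    ∥c∥≤1 : ∥ c ∥ ≼ 1ℚ
    ∥c∥≤1 = subst (_≼ 1ℚ)
      (sym (ℚ.0≤p⇒∣p∣≡p (ℚ.≤-trans (from-yes (0ℚ ℚ.≤? ⅓)) (e⁻¹.≥⅓ 4≤n))))
      (ℚ.≤-trans (e⁻¹.≤½ 4≤n) (from-yes (½ ℚ.≤? 1ℚ)))

-- Nonvanishing on the half-line

record LipschitzOn {m} (R : ℚ) (as : Vec ℝ m) : Set where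
  field
    B L        : ℚ
    0≤L        : 0ℚ ≼ L
    estimates  : Eventually λ n →
      (∀ {x} → ∥ x ∥ ≼ R → ∥ evalAt as n x ∥ ≼ B) ×
      (∀ {x y} → ∥ x ∥ ≼ R → ∥ y ∥ ≼ R → ∥ evalAt as n x ⊖ evalAt as n y ∥ ≼ L ⊗ ∥ x ⊖ y ∥)
    0≤B        : 0ℚ ≼ B

-- The constants are shared by all large `n`, because the approximations of each coefficient are
-- eventually bounded; a neighbourhood can therefore be chosen before `n`.
lipschitzOn : ∀ {m R} → 0ℚ ≼ R → (as : Vec ℝ m) → LipschitzOn R as
lipschitzOn 0≤R [] = record
  { B = 0ℚ; L = 0ℚ; 0≤B = ℚ.≤-refl; 0≤L = ℚ.≤-refl
  ; estimates = 0 , λ _ → (λ _ → ℚ.≤-refl) , λ {x} {y} _ _ → ℚ.≤-reflexive (sym (ℚ.*-zeroˡ ∥ x ⊖ y ∥))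
  }
lipschitzOn {R = R} 0≤R (a ∷ as) with bounded a | lipschitzOn 0≤R as
... | A , 0<A , a≤A | record { B = B; L = L; 0≤B = 0≤B; 0≤L = 0≤L; estimates = estimates } = record
  { B = A ⊕ R ⊗ B
  ; L = R ⊗ L ⊕ B
  ; 0≤B = ℚ.+-mono-≤ (ℚ.<⇒≤ 0<A) (*-nonNeg 0≤R 0≤B)
  ; 0≤L = ℚ.+-mono-≤ (*-nonNeg 0≤R 0≤L) 0≤B
  ; estimates = map (λ {n} → step n) (a≤A ∩ estimates)
  }
  where
  step : ∀ n → ∥ seq a n ∥ ≼ A ×
    (∀ {x} → ∥ x ∥ ≼ R → ∥ evalAt as n x ∥ ≼ B) ×
    (∀ {x y} → ∥ x ∥ ≼ R → ∥ y ∥ ≼ R → ∥ evalAt as n x ⊖ evalAt as n y ∥ ≼ L ⊗ ∥ x ⊖ y ∥) →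
    (∀ {x} → ∥ x ∥ ≼ R → ∥ seq a n ⊕ x ⊗ evalAt as n x ∥ ≼ A ⊕ R ⊗ B) ×
    (∀ {x y} → ∥ x ∥ ≼ R → ∥ y ∥ ≼ R →
      ∥ (seq a n ⊕ x ⊗ evalAt as n x) ⊖ (seq a n ⊕ y ⊗ evalAt as n y) ∥ ≼ (R ⊗ L ⊕ B) ⊗ ∥ x ⊖ y ∥)
  step n (a≤ , bound , lip) =
    (λ {x} x≤R → ∣+∣-mono {seq a n} a≤ (∣*∣-mono {x} x≤R (bound x≤R))) ,
    λ {x} {y} x≤R y≤R → begin
      ∥ (seq a n ⊕ x ⊗ evalAt as n x) ⊖ (seq a n ⊕ y ⊗ evalAt as n y) ∥
        ≡⟨ cong ∥_∥ (solve 5 (λ a x y u v →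
             (a :+ x :* u) :- (a :+ y :* v) := x :* (u :- v) :+ (x :- y) :* v) refl
             (seq a n) x y (evalAt as n x) (evalAt as n y)) ⟩
      ∥ x ⊗ (evalAt as n x ⊖ evalAt as n y) ⊕ (x ⊖ y) ⊗ evalAt as n y ∥
        ≤⟨ ∣+∣-mono {x ⊗ (evalAt as n x ⊖ evalAt as n y)}
             (∣*∣-mono {x} x≤R (lip x≤R y≤R)) (∣*∣-mono {x ⊖ y} ℚ.≤-refl (bound y≤R)) ⟩
      R ⊗ (L ⊗ ∥ x ⊖ y ∥) ⊕ ∥ x ⊖ y ∥ ⊗ B
        ≡⟨ solve 4 (λ R L D B → R :* (L :* D) :+ D :* B := (R :* L :+ B) :* D) refl R L ∥ x ⊖ y ∥ B ⟩
      (R ⊗ L ⊕ B) ⊗ ∥ x ⊖ y ∥ ∎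

-- Dividing min(ε, 1) by K + 1 instead of `K` also covers K = 0 and gives δ ≤ 1.
scale≤ : ∀ {K ε} → 0ℚ ≼ K → 0ℚ ≺ ε → Σ ℚ λ δ → 0ℚ ≺ δ × δ ≼ 1ℚ × K ⊗ δ ≼ ε
scale≤ {K} {ε} 0≤K 0<ε with scale {K ⊕ 1ℚ} {ε ℚ.⊓ 1ℚ} (ℚ.+-mono-≤-< 0≤K 0<1) 0<ε⊓1
  where
  0<ε⊓1 : 0ℚ ≺ ε ℚ.⊓ 1ℚ
  0<ε⊓1 with ℚ.⊓-sel ε 1ℚ
  ... | inj₁ eq = subst (0ℚ ≺_) (sym eq) 0<ε
  ... | inj₂ eq = subst (0ℚ ≺_) (sym eq) 0<1
... | δ , 0<δ , eq = δ , 0<δ ,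
  (begin
    δ                ≡⟨ trans (cong (_⊕ δ) (ℚ.*-zeroˡ δ)) (ℚ.+-identityˡ δ) ⟨
    0ℚ ⊗ δ ⊕ δ       ≤⟨ ℚ.+-monoˡ-≤ δ (ℚ.*-monoʳ-≤-nonNeg δ {{ℚ.nonNegative (ℚ.<⇒≤ 0<δ)}} 0≤K) ⟩
    K ⊗ δ ⊕ δ        ≡⟨ total ⟩
    ε ℚ.⊓ 1ℚ         ≤⟨ ℚ.p⊓q≤q ε 1ℚ ⟩
    1ℚ               ∎) ,
  (begin
    K ⊗ δ            ≡⟨ ℚ.+-identityʳ (K ⊗ δ) ⟨
    K ⊗ δ ⊕ 0ℚ       ≤⟨ ℚ.+-monoʳ-≤ (K ⊗ δ) (ℚ.<⇒≤ 0<δ) ⟩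
    K ⊗ δ ⊕ δ        ≡⟨ total ⟩
    ε ℚ.⊓ 1ℚ         ≤⟨ ℚ.p⊓q≤p ε 1ℚ ⟩
    ε                ∎)
  where
  total : K ⊗ δ ⊕ δ ≡ ε ℚ.⊓ 1ℚ
  total = trans (solve 2 (λ K d → K :* d :+ d := (K :+ con 1ℚ) :* d) refl K δ) eq

∥expSum∥≤ : ∀ {q K} → ∥ q ∥ ≼ K → ∀ n → ∥ expSum q n ∥ ≼ expSum K n
∥expSum∥≤ q≤K zero            = ∥term∥≤ q≤K 0
∥expSum∥≤ {q} q≤K (suc n) = ∣+∣-mono {expSum q n} (∥expSum∥≤ q≤K n) (∥term∥≤ q≤K (suc n))

0≤node : ∀ {x₀ h} → 0ℚ ≼ x₀ → 0ℚ ≼ h → ∀ k → 0ℚ ≼ node x₀ h k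
0≤node 0≤x₀ 0≤h k = ℚ.+-mono-≤ 0≤x₀ (*-nonNeg (0≤ι k) 0≤h)

∥leading∥≤ : ∀ {d} x₀ h (as : Vec ℝ (suc d)) n {η} →
  (∀ k → k ℕ.≤ d → ∥ samples x₀ h as n k ∥ ≼ η) →
  ∥ scaledFactorial h d ⊗ seq (last as) n ∥ ≼ η ⊗ ι 2 ^ d
∥leading∥≤ {d} x₀ h as n {η} f≤ = subst₂ _≼_
  (cong ∥_∥ (Δ-leading x₀ h as n 0)) (ℚ.*-identityʳ (η ⊗ ι 2 ^ d))
  (∥Δ∥≤ η 1ℚ f (λ {k} k≤d → subst (∥ f k ∥ ≼_)
    (sym (trans (cong (η ⊗_) (1^ k)) (ℚ.*-identityʳ η))) (f≤ k k≤d))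
    d (ℕ.≤-reflexive (ℕ.+-identityʳ d)))
  where
  f : ℕ → ℚ
  f = samples x₀ h as n

-- The d-th difference of d + 1 samples recovers the leading coefficient times d! hᵈ, and a uniform
-- bound on the samples grows by at most 2ᵈ.
small-samples⇒leading≈0 : ∀ {d} x₀ {h} → 0ℚ ≺ h → (as : Vec ℝ (suc d)) →
  (∀ k → k ℕ.≤ d → ∀ {ε} → 0ℚ ≺ ε → Eventually λ n → ∥ samples x₀ h as n k ∥ ≼ ε) → last as ≈ 0ℝ
small-samples⇒leading≈0 {d} x₀ {h} 0<h as small = mk≈ λ {ε} 0<ε →
  let η , 0<η , 2ᵈη≡κε = scale {ι 2 ^ d} {κ ⊗ ε} 0<2ᵈ (*-pos 0<κ 0<ε)
  in map (λ {n} → leading≤ ε η 2ᵈη≡κε n)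
       (eventually-∀≤ (λ k n → ∥ samples x₀ h as n k ∥ ≼ η) d λ k k≤d → small k k≤d 0<η)
  where
  κ = scaledFactorial h d
  0<κ : 0ℚ ≺ κ
  0<κ = scaledFactorial-pos 0<h d
  0<2ᵈ : 0ℚ ≺ ι 2 ^ d
  0<2ᵈ = ℚ.<-≤-trans 0<1 (subst (_≼ ι 2 ^ d) (1^ d) (^-mono-≤ 0≤1 (ι-mono {1} {2} (s≤s z≤n)) d))
  leading≤ : ∀ ε η → ι 2 ^ d ⊗ η ≡ κ ⊗ ε → ∀ n →
    (∀ k → k ℕ.≤ d → ∥ samples x₀ h as n k ∥ ≼ η) → ∥ seq (last as) n ⊖ 0ℚ ∥ ≼ ε
  leading≤ ε η 2ᵈη≡κε n f≤ = *-cancel-≤ {κ} {∥ a ⊖ 0ℚ ∥} {ε} 0<κ (begin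
    κ ⊗ ∥ a ⊖ 0ℚ ∥    ≡⟨ cong₂ (λ x y → x ⊗ ∥ y ∥) (sym (ℚ.0≤p⇒∣p∣≡p (ℚ.<⇒≤ 0<κ))) (ℚ.+-identityʳ a) ⟩
    ∥ κ ∥ ⊗ ∥ a ∥     ≡⟨ ℚ.∣p*q∣≡∣p∣*∣q∣ κ a ⟨
    ∥ κ ⊗ a ∥         ≤⟨ ∥leading∥≤ x₀ h as n f≤ ⟩
    η ⊗ ι 2 ^ d       ≡⟨ ℚ.*-comm η (ι 2 ^ d) ⟩
    ι 2 ^ d ⊗ η       ≡⟨ 2ᵈη≡κε ⟩
    κ ⊗ ε             ∎)
    where a = seq (last as) n

-- The assumed closeness would give |r| ≤ A + 1, so `θ` is set to make |P r| at most ½, although P r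
-- = 1.
small⇒reciprocal-large : ∀ {A e P r s θ} → e ≼ 1ℚ → (A ⊕ 1ℚ) ⊗ θ ≡ ½ →
  ∥ P ∥ ≼ θ → P ⊗ r ≡ 1ℚ → ∥ s ∥ ≼ A → ¬ (∥ s ⊖ r ∥ ≼ e)
small⇒reciprocal-large {A} {e} {P} {r} {s} {θ} e≤1 [A+1]θ≡½ P≤θ Pr≡1 s≤A close = ℚ.<-irrefl refl (begin-strict
  ½                    <⟨ from-yes (½ ℚ.<? 1ℚ) ⟩
  ∥ 1ℚ ∥               ≡⟨ cong ∥_∥ Pr≡1 ⟨
  ∥ P ⊗ r ∥            ≤⟨ ∣*∣-mono {P} P≤θ r≤A+1 ⟩
  θ ⊗ (A ⊕ 1ℚ)         ≡⟨ ℚ.*-comm θ (A ⊕ 1ℚ) ⟩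
  (A ⊕ 1ℚ) ⊗ θ         ≡⟨ [A+1]θ≡½ ⟩
  ½                    ∎)
  where
  r≤A+1 : ∥ r ∥ ≼ A ⊕ 1ℚ
  r≤A+1 = ℚ.≤-trans (∣∣-shift r s)
    (ℚ.+-mono-≤ s≤A (ℚ.≤-trans (subst (_≼ e) (∣-∣-comm s r) close) e≤1))

module _ {d} (p : Polynomial d) {M e} (e≤1 : e ≼ 1ℚ) (M<e : M < fromℚ e) (error≤M : sup (error p) M) where

  error≤ : ∀ {x} → 0ℚ ≼ x → ⟦ p ⟧ (fromℚ x) # 0ℝ → Eventually λ n →
    ∥ expSum (ℚ.- x) n ⊖ recip (evalAt (coefficients p) n x) ∥ ≼ e
  error≤ {x} 0≤x px#0 = ≤∧<⇒eventually≤ (error≤M (mkPoint (fromℚ x) (mk≤ λ 0<ε → 0 , λ _ →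
    ℚ.+-mono-≤ 0≤x (ℚ.<⇒≤ 0<ε)) px#0)) M<e

  -- Near a zero, p would be small, yet 1/p stays bounded wherever p is nonzero;
  -- so p would vanish on a whole interval.
  nonvanishing : ∀ {x₀} → 0ℚ ≼ x₀ → ¬ ¬ (⟦ p ⟧ (fromℚ x₀) # 0ℝ)
  nonvanishing {x₀} 0≤x₀ ¬px₀#0 = leading≉0 p (small-samples⇒leading≈0 x₀ 0<h as λ k k≤d →
    ¬#0⇒small (⟦ p ⟧ (fromℚ (x k))) (vanishes k k≤d))
    where
    as = coefficients p
    R = x₀ ⊕ 1ℚ
    0≤R : 0ℚ ≼ R
    0≤R = ℚ.+-mono-≤ 0≤x₀ 0≤1
    open LipschitzOn (lipschitzOn 0≤R as)

    exp-bound = expSum-bounded R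
    A = proj₁ exp-bound
    0<A : 0ℚ ≺ A
    0<A = proj₁ (proj₂ exp-bound)
    0<A+1 : 0ℚ ≺ A ⊕ 1ℚ
    0<A+1 = ℚ.+-mono-≤-< (ℚ.<⇒≤ 0<A) 0<1

    θ-data = scale {A ⊕ 1ℚ} {½} 0<A+1 0<½
    θ = proj₁ θ-data
    0<θ : 0ℚ ≺ θ
    0<θ = proj₁ (proj₂ θ-data)
    -- Within distance `σ` of `x₀` the values change by at most θ/2. The choice of `h` keeps all `d`
    -- steps within `σ`, and σ ≤ 1 keeps the nodes below `R`.
    σ-data = scale≤ {L} {θ ⊗ ½} 0≤L (0<half 0<θ)
    σ = proj₁ σ-data
    h-data = scale≤ {ι d} {σ} (0≤ι d) (proj₁ (proj₂ σ-data))
    h = proj₁ h-data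
    0<h : 0ℚ ≺ h
    0<h = proj₁ (proj₂ h-data)

    x : ℕ → ℚ
    x = node x₀ h

    0≤x : ∀ k → 0ℚ ≼ x k
    0≤x = 0≤node 0≤x₀ (ℚ.<⇒≤ 0<h)

    kh≤σ : ∀ {k} → k ℕ.≤ d → ι k ⊗ h ≼ σ
    kh≤σ k≤d = ℚ.≤-trans (ℚ.*-monoʳ-≤-nonNeg h {{ℚ.nonNegative (ℚ.<⇒≤ 0<h)}} (ι-mono k≤d))
      (proj₂ (proj₂ (proj₂ h-data)))

    ∥x∥≤R : ∀ {k} → k ℕ.≤ d → ∥ x k ∥ ≼ R
    ∥x∥≤R {k} k≤d = subst (_≼ R) (sym (ℚ.0≤p⇒∣p∣≡p (0≤x k)))
      (ℚ.+-monoʳ-≤ x₀ (ℚ.≤-trans (kh≤σ k≤d) (proj₁ (proj₂ (proj₂ σ-data)))))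

    ∥x₀∥≤R : ∥ x₀ ∥ ≼ R
    ∥x₀∥≤R = subst₂ _≼_ (sym (trans (ℚ.0≤p⇒∣p∣≡p 0≤x₀) (sym (ℚ.+-identityʳ x₀)))) refl (ℚ.+-monoʳ-≤ x₀ 0≤1)

    small : ∀ k → k ℕ.≤ d → Eventually λ n → ∥ evalAt as n (x k) ∥ ≼ θ
    small k k≤d = map (λ {n} ((_ , lip) , at-x₀) → begin
      ∥ evalAt as n (x k) ∥                                              ≤⟨ ∣∣-shift (evalAt as n (x k)) (evalAt as n x₀) ⟩
      ∥ evalAt as n x₀ ∥ ⊕ ∥ evalAt as n (x k) ⊖ evalAt as n x₀ ∥        ≤⟨ ℚ.+-mono-≤ at-x₀ (lip (∥x∥≤R k≤d) ∥x₀∥≤R) ⟩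
      θ ⊗ ½ ⊕ L ⊗ ∥ x k ⊖ x₀ ∥                                           ≤⟨ ℚ.+-monoʳ-≤ (θ ⊗ ½) Lσ≤ ⟩
      θ ⊗ ½ ⊕ θ ⊗ ½                                                      ≡⟨ half+half θ ⟩
      θ                                                                  ∎)
      (estimates ∩ ¬#0⇒small (⟦ p ⟧ (fromℚ x₀)) ¬px₀#0 (0<half 0<θ))
      where
      Lσ≤ : L ⊗ ∥ x k ⊖ x₀ ∥ ≼ θ ⊗ ½
      Lσ≤ = begin
        L ⊗ ∥ x k ⊖ x₀ ∥      ≡⟨ cong (λ y → L ⊗ ∥ y ∥) (solve 2 (λ a b → (a :+ b) :- a := b) refl x₀ (ι k ⊗ h)) ⟩
        L ⊗ ∥ ι k ⊗ h ∥       ≡⟨ cong (L ⊗_) (ℚ.0≤p⇒∣p∣≡p (*-nonNeg (0≤ι k) (ℚ.<⇒≤ 0<h))) ⟩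
        L ⊗ (ι k ⊗ h)         ≤⟨ ℚ.*-monoˡ-≤-nonNeg L {{ℚ.nonNegative 0≤L}} (kh≤σ k≤d) ⟩
        L ⊗ σ                 ≤⟨ proj₂ (proj₂ (proj₂ σ-data)) ⟩
        θ ⊗ ½                 ∎

    vanishes : ∀ k → k ℕ.≤ d → ¬ (⟦ p ⟧ (fromℚ (x k)) # 0ℝ)
    vanishes k k≤d px#0 =
      let n , P≤θ , close , Pr≡1 , expR≤A = witness
            (small k k≤d ∩ error≤ (0≤x k) px#0 ∩ #0⇒*-recip (⟦ p ⟧ (fromℚ (x k))) px#0 ∩ proj₂ (proj₂ exp-bound))
      in small⇒reciprocal-large {A} {e} {evalAt as n (x k)} {recip (evalAt as n (x k))} {expSum (ℚ.- x k) n} {θ}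
           e≤1 (proj₂ (proj₂ θ-data)) P≤θ Pr≡1
           (ℚ.≤-trans (∥expSum∥≤ (subst (_≼ R) (sym (ℚ.∣-p∣≡∣p∣ (x k))) (∥x∥≤R k≤d)) n)
             (ℚ.≤-trans (p≤∣p∣ (expSum R n)) expR≤A)) close

-- Contradiction at a common index

theorem4p2 : Σ ℕ λ d₀ → ∀ d → d₀ ℕ.≤ d → (p : Polynomial d) →
    fromℚ ((+ 1 / 50) ^ d) ≤ᵉ sup (error p)
theorem4p2 = 3 , λ d 3≤d p M error≤M → fromℚ≤-stable M λ M<e →
  ¬¬-∀≤ (λ k → ⟦ p ⟧ (fromℚ (node 0ℚ 1ℚ k)) # 0ℝ) (suc d)
    (λ k _ → nonvanishing p (e≤1 d) M<e error≤M (0≤node ℚ.≤-refl 0≤1 k))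
    λ p#0 → absurd 3≤d p (witness (eventually-∀≤ _ (suc d) (λ k k≤ →
        #0⇒*-recip (⟦ p ⟧ (fromℚ (node 0ℚ 1ℚ k))) (p#0 k k≤) ∩
        error≤ p (e≤1 d) M<e error≤M (0≤node ℚ.≤-refl 0≤1 k) (p#0 k k≤) ∩
        exp-power k (0<e d))
      ∩ (4 , λ n≥ → n≥)))
  where
  e≤1 : ∀ d → 1/50 ^ d ≼ 1ℚ
  e≤1 d = ^-anti-≤ (from-yes (0ℚ ℚ.≤? 1/50)) (from-yes (1/50 ℚ.≤? 1ℚ)) {m = d} z≤n

  0<e : ∀ d → 0ℚ ≺ 1/50 ^ d
  0<e zero    = 0<1
  0<e (suc d) = *-pos (from-yes (0ℚ ℚ.<? 1/50)) (0<e d)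

  absurd : ∀ {d} → 3 ℕ.≤ d → (p : Polynomial d) → ¬ Σ ℕ λ n →
    (∀ k → k ℕ.≤ suc d →
      samples 0ℚ 1ℚ (coefficients p) n k ⊗ recip (samples 0ℚ 1ℚ (coefficients p) n k) ≡ 1ℚ ×
      ∥ expSum (ℚ.- node 0ℚ 1ℚ k) n ⊖ recip (samples 0ℚ 1ℚ (coefficients p) n k) ∥ ≼ 1/50 ^ d ×
      ∥ expSum (ℚ.- 1ℚ) n ^ k ⊖ expSum (ℚ.- node 0ℚ 1ℚ k) n ∥ ≼ 1/50 ^ d) ×
    4 ℕ.≤ n
  absurd {d} 3≤d p (n , at , 4≤n) = ℚ.<-irrefl refl (begin-strict
    -- The tolerance supplied is 2e: one `e` from the error of 1/p, one from replacing the
    -- exponential by a power. Inverting doubles it again, whence the factor 4.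
    1ℚ                                  ≤⟨ 1≤2e*10^ as n r (e⁻¹.≥⅓ 4≤n) (e⁻¹.≤½ 4≤n)
                                             (subst (_≼ ⅓ ^ suc d) (sym 4e) (4*50⁻ᵈ≤3⁻ᵈ 3≤d))
                                             (λ {k} k≤ → proj₁ (at k k≤)) (λ {k} → close k) ⟩
    ((e ⊕ e) ⊕ (e ⊕ e)) ⊗ ι 10 ^ suc d  ≡⟨ cong (_⊗ ι 10 ^ suc d) 4e ⟩
    (ι 4 ⊗ e) ⊗ ι 10 ^ suc d            <⟨ 4*50⁻ᵈ*10ᵈ<1 3≤d ⟩
    1ℚ                                  ∎)
    where
    as = coefficients p
    e = 1/50 ^ d
    r : ℕ → ℚ
    r k = recip (samples 0ℚ 1ℚ as n k)
    4e : (e ⊕ e) ⊕ (e ⊕ e) ≡ ι 4 ⊗ e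
    4e = solve 1 (λ e → (e :+ e) :+ (e :+ e) := con (ι 4) :* e) refl e
    close : ∀ k → k ℕ.≤ suc d → ∥ expSum (ℚ.- 1ℚ) n ^ k ⊖ r k ∥ ≼ e ⊕ e
    close k k≤ = ℚ.≤-trans (triangle (expSum (ℚ.- 1ℚ) n ^ k) (expSum (ℚ.- node 0ℚ 1ℚ k) n) (r k))
      (ℚ.+-mono-≤ (proj₂ (proj₂ (at k k≤))) (proj₁ (proj₂ (at k k≤))))
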